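{- Let $T$ be any tree poset of height $2$ with $t+1$ elements. Then for any $\varepsilon>0$ there exist $\delta>0$ and $n_0$ such that for any $n\ge n_0$, any family $\mathcal F\subseteq 2^{[n]}$ of size $|\mathcal F|\ge(1+\varepsilon)\binom{n}{\lfloor n/2\rfloor}$ contains at least $\delta n^t\binom{n}{\lfloor n/2\rfloor}$ copies of $T$.
   Context: For a finite poset $(P,\le)$ and a family $\mathcal F\subseteq 2^{[n]}$, a (non-induced) copy of $P$ in $\mathcal F$ is a subfamily $\mathcal G\subseteq\mathcal F$ for which there is a bijection $i:P\to\mathcal G$ such that $p\le q$ implies $i(p)\subseteq i(q)$. The Hasse diagram of $P$ is the directed graph on $P$ with an arc $pq$ whenever $p<q$ and there is no $z$ with $p<z<q$. $P$ is a tree poset if its Hasse diagram with orientations removed is a tree. The height of $P$ is the maximum number of elements in a chain of $P$. -}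

module Defs where

open import Level using (0ℓ)
open import Data.Nat as ℕ using (ℕ; suc; _≤_; _^_; ⌊_/2⌋)
open import Data.Nat.Combinatorics using (_C_)
open import Data.Integer using (+_)
open import Data.Rational as ℚ using (ℚ; _/_; 0ℚ; 1ℚ)
open import Data.Fin using (Fin)
open import Data.Fin.Subset using (Subset; _⊆_)
open import Data.List using (List; []; _∷_; _++_; length)
open import Data.List.Membership.Propositional using (_∈_)
open import Data.List.Relation.Unary.Unique.Propositional using (Unique)
open import Data.List.Relation.Unary.Linked using (Linked)
open import Data.List.Relation.Unary.AllPairs using (AllPairs)
open import Data.List.Relation.Unary.All using (All)
open import Data.Product using (Σ; ∃; ∃-syntax; _×_)
open import Data.Sum using (_⊎_)
open import Relation.Nullary using (¬_)
open import Relation.Binary using (Rel; IsPartialOrder)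
open import Relation.Binary.PropositionalEquality using (_≡_; _≢_)
open import Function using (Injective; _⇔_)

ℕ→ℚ : ℕ → ℚ
ℕ→ℚ n = (+ n) / 1

module FinPoset {m : ℕ} (_≼_ : Rel (Fin m) 0ℓ) where

  _≺_ : Rel (Fin m) 0ℓ
  p ≺ q = (p ≼ q) × (p ≢ q)

  HasseArc : Rel (Fin m) 0ℓ
  HasseArc p q = (p ≺ q) × (¬ (∃[ z ] ((p ≺ z) × (z ≺ q))))

  Adj : Rel (Fin m) 0ℓ
  Adj p q = HasseArc p q ⊎ HasseArc q p

  data Walk : Fin m → Fin m → Set where
    here : ∀ {p} → Walk p p
    step : ∀ {p q r} → Adj p q → Walk q r → Walk p r

  Connected : Set
  Connected = ∀ p q → Walk p q

  HasCycle : Set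
  HasCycle = ∃[ x ] ∃[ xs ] ((2 ≤ length xs) × Unique (x ∷ xs)
                               × Linked Adj (x ∷ xs ++ x ∷ []))

  IsTreePoset : Set
  IsTreePoset = Connected × ¬ HasCycle

  Comparable : Rel (Fin m) 0ℓ
  Comparable p q = (p ≼ q) ⊎ (q ≼ p)

  IsChain : List (Fin m) → Set
  IsChain cs = Unique cs × AllPairs Comparable cs

  HasHeight : ℕ → Set
  HasHeight h = (∃[ cs ] (IsChain cs × length cs ≡ h))
              × (∀ cs → IsChain cs → length cs ≤ h)

-- A family F ⊆ 2^[n] is a duplicate-free list of subsets of [n];
-- |F| = length F.

record Copy {m n : ℕ} (_≼_ : Rel (Fin m) 0ℓ) (F : List (Subset n)) : Set where
  field
    emb      : Fin m → Subset n
    injective : Injective _≡_ _≡_ emb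
    monotone  : ∀ {p q} → p ≼ q → emb p ⊆ emb q
    inF       : ∀ p → emb p ∈ F
open Copy public

InImage : ∀ {m n} {_≼_ : Rel (Fin m) 0ℓ} {F : List (Subset n)} →
          Copy _≼_ F → Subset n → Set
InImage c A = ∃[ p ] (emb c p ≡ A)

SameSubfamily : ∀ {m n} {_≼_ : Rel (Fin m) 0ℓ} {F : List (Subset n)} →
                Copy _≼_ F → Copy _≼_ F → Set
SameSubfamily c d = ∀ A → InImage c A ⇔ InImage d A

AtLeastCopies : ∀ {m n} (_≼_ : Rel (Fin m) 0ℓ) (F : List (Subset n)) → ℚ → Set
AtLeastCopies _≼_ F N =
  Σ (List (Copy _≼_ F)) λ cs → (AllPairs (λ c d → ¬ SameSubfamily c d) cs
           × N ℚ.≤ ℕ→ℚ (length cs))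

midBinom : ℕ → ℕ
midBinom n = n C ⌊ n /2⌋

{-# OPTIONS --safe #-}
-- Kleitman's supersaturation bound by a random walk: start at a random set and repeatedly add a random
-- element, the step from level b to level b + 1 having probability 1 / max (n - b) (b + 1) for each edge.
-- Fresh walkers are added so that each set is visited with expectation 1; their total mass is then the middle
-- binomial M. Since the first visits to F have mass at most M, the repeated visits have mass at least |F| - M,
-- and each comparable pair of F contributes at most 2 / (n + 1) to them. Hence a family of size (1 + ε) M has
-- at least c n |F| comparable pairs.
-- The tree is then embedded in the comparability graph leaf by leaf: before each leaf is attached, the pairs
-- at vertices of degree below τ ~ c' n are discarded, which costs at most 2 |F| τ pairs per leaf, so every
-- vertex in use has at least τ - t choices for the new leaf.
module Submission where

open import Defs
open import Data.Bool using (true; false; if_then_else_)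
import Data.Bool.Properties as Bool
open import Data.Fin as Fin using (Fin; zero; suc)
open import Data.Fin.Properties using (injective⇒≤; any?; all?)
open import Data.Fin.Subset using (Subset; inside; outside; ∣_∣; _⊂_; _⊆_)
open import Data.Fin.Subset.Properties using (s⊂s; out⊂in; ⊆-refl; p⊂q⇒∣p∣<∣q∣; ⊂-trans; ⊂-irref; _⊂?_; ∣p∣≤n)
open import Data.List using (List; []; _∷_; _++_; length; map; filter; concatMap; cartesianProduct; cartesianProductWith)
open import Data.List.Membership.Propositional using (_∈_; _∉_; find)
open import Data.List.Membership.Propositional.Properties
  using (∈-∃++; ∈-++⁺ˡ; ∈-++⁺ʳ; ∈-++⁻; ∈-map⁺; ∈-map⁻; ∈-filter⁻; ∈-cartesianProduct⁻; ∈-cartesianProductWith⁺; ∈-concatMap⁺; ∈-concatMap⁻)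
import Data.List.Membership.DecPropositional as DecMembership
open import Data.List.Properties using (map-∘; map-++; length-map; length-++)
open import Data.List.Relation.Binary.Permutation.Propositional using (_↭_; ↭-refl; ↭-trans; prep)
open import Data.List.Relation.Binary.Permutation.Propositional.Properties using (shift; ∈-resp-↭; map⁺)
open import Data.List.Relation.Unary.All as All using (All; []; _∷_)
open import Data.List.Relation.Unary.All.Properties using (¬Any⇒All¬)
open import Data.List.Relation.Unary.AllPairs using (AllPairs; []; _∷_)
open import Data.List.Relation.Unary.Any as Any using (Any; here; there)
open import Data.List.Relation.Unary.Linked using (Linked; [-]; _∷_)
open import Data.List.Relation.Unary.Unique.Propositional using (Unique)
import Data.List.Relation.Unary.Unique.Propositional.Properties as Unique
open import Data.Product using (Σ; ∃-syntax; _×_; _,_; proj₁; proj₂)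
open import Data.Sum as Sum using (inj₁; inj₂)
open import Data.Vec using (Vec; []; _∷_; lookup; toList)
import Data.Vec.Membership.DecPropositional as DecVec
import Data.Vec.Membership.Propositional as Vec
open import Data.Vec.Membership.Propositional.Properties using (∈-lookup; ∈-toList⁺)
open import Data.Vec.Properties using (≡-dec; ∷-injectiveˡ; ∷-injectiveʳ; length-toList)
import Data.Vec.Relation.Unary.Any as VecAny
open import Data.Vec.Relation.Unary.Any.Properties using (lookup-index)
open import Function using (_∘_; Injective; Equivalence)
open import Level using (Level; 0ℓ)
open import Relation.Binary using (Rel; Decidable; DecidableEquality; IsPartialOrder)
open import Relation.Binary.PropositionalEquality
open import Relation.Nullary using (¬_; ¬?; Dec; yes; no; does; contradiction)
open import Relation.Nullary.Decidable using (_×-dec_; decidable-stable)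

-- Of the cover pairs between levels b and b + 1, n - b leave each lower set and b + 1 enter each
-- upper one. The maximum of the two keeps both the outgoing probability and the incoming mass at
-- most 1, and it is at least (n + 1) / 2, whence 2 / (n + 1) per comparable pair. Below the middle
-- nobody stops and from the middle on nobody is added, so the total mass is the middle binomial.
-- The number of pairs has to be proportional to |F| and not merely to M, because pruning discards a
-- multiple of |F|, which may far exceed M. A leaf has one parent, so a lower bound on the degree of
-- a single vertex suffices to attach it; and in height two every strict relation is a tree edge, so
-- nothing else has to be preserved. Labelled embeddings overcount copies only by a factor depending
-- on t. All masses are multiplied by a common denominator and ε is replaced by the reciprocal of an
-- integer, so the argument runs in ℕ.

module Counting where

  open import Data.Nat
  open import Data.Nat.Combinatorics using (_C_; nCn≡1; nCk≡nC[n∸k]; nCk+nC[k+1]≡[n+1]C[k+1]; k>n⇒nCk≡0)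
  open import Data.Nat.DivMod using (_/_; _%_; m/n*n≤m; m≡m%n+[m/n]*n; m%n<n)
  open import Data.Nat.ListAction using (sum)
  open import Data.Nat.ListAction.Properties using (sum-++; sum-↭)
  open import Data.Nat.Properties
  open import Data.Nat.Tactic.RingSolver using (solve-∀)

  private variable
    a b ℓ ℓ₁ ℓ₂ : Level
    A : Set a
    B : Set b
    P : Set ℓ
    Q : Set ℓ₁
    R : Set ℓ₂
    n : ℕ

  -- Indicators and sums over lists.

  ∑ : List A → (A → ℕ) → ℕ
  ∑ xs f = sum (map f xs)

  𝟙 : Dec P → ℕ
  𝟙 P? = if does P? then 1 else 0

  𝟙-mono : (P → Q) → (P? : Dec P) (Q? : Dec Q) → 𝟙 P? ≤ 𝟙 Q?
  𝟙-mono P→Q (no _)  Q?      = z≤n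
  𝟙-mono P→Q (yes p) (yes _) = ≤-refl
  𝟙-mono P→Q (yes p) (no ¬q) = contradiction (P→Q p) ¬q

  𝟙-yes : (P? : Dec P) → P → 𝟙 P? ≡ 1
  𝟙-yes (yes _) p = refl
  𝟙-yes (no ¬p) p = contradiction p ¬p

  𝟙-no : (P? : Dec P) → ¬ P → 𝟙 P? ≡ 0
  𝟙-no (yes p) ¬p = contradiction p ¬p
  𝟙-no (no _)  ¬p = refl

  𝟙-disjoint : (P → R) → (Q → R) → (P → ¬ Q) → (P? : Dec P) (Q? : Dec Q) (R? : Dec R) → 𝟙 P? + 𝟙 Q? ≤ 𝟙 R?
  𝟙-disjoint P→R Q→R P→¬Q (yes p) (yes q) R? = contradiction q (P→¬Q p)
  𝟙-disjoint P→R Q→R P→¬Q (yes p) (no _)  R? = 𝟙-mono P→R (yes p) R?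
  𝟙-disjoint P→R Q→R P→¬Q (no _)  Q?      R? = 𝟙-mono Q→R Q? R?

  module _ {A : Set a} where

    ∑-mono-∈ : ∀ (xs : List A) {f g : A → ℕ} → (∀ {x} → x ∈ xs → f x ≤ g x) → ∑ xs f ≤ ∑ xs g
    ∑-mono-∈ [] h = z≤n
    ∑-mono-∈ (x ∷ xs) h = +-mono-≤ (h (here refl)) (∑-mono-∈ xs (h ∘ there))

    ∑-mono : ∀ (xs : List A) {f g : A → ℕ} → (∀ x → f x ≤ g x) → ∑ xs f ≤ ∑ xs g
    ∑-mono xs h = ∑-mono-∈ xs λ {x} _ → h x

    ∑-cong-∈ : ∀ (xs : List A) {f g : A → ℕ} → (∀ {x} → x ∈ xs → f x ≡ g x) → ∑ xs f ≡ ∑ xs g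
    ∑-cong-∈ [] h = refl
    ∑-cong-∈ (x ∷ xs) h = cong₂ _+_ (h (here refl)) (∑-cong-∈ xs (h ∘ there))

    ∑-distrib-+ : ∀ (xs : List A) (f g : A → ℕ) → ∑ xs (λ x → f x + g x) ≡ ∑ xs f + ∑ xs g
    ∑-distrib-+ [] f g = refl
    ∑-distrib-+ (x ∷ xs) f g = trans (cong (f x + g x +_) (∑-distrib-+ xs f g)) (lemma (f x) (g x) _ _)
      where
      lemma : ∀ p q r s → p + q + (r + s) ≡ p + r + (q + s)
      lemma = solve-∀

    *-distribˡ-∑ : ∀ (xs : List A) c (f : A → ℕ) → c * ∑ xs f ≡ ∑ xs (λ x → c * f x)
    *-distribˡ-∑ [] c f = *-zeroʳ c
    *-distribˡ-∑ (x ∷ xs) c f = trans (*-distribˡ-+ c (f x) _) (cong (c * f x +_) (*-distribˡ-∑ xs c f))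

    ∑-const : ∀ (xs : List A) c → ∑ xs (λ _ → c) ≡ length xs * c
    ∑-const [] c = refl
    ∑-const (x ∷ xs) c = cong (c +_) (∑-const xs c)

    length≡∑1 : ∀ (xs : List A) → length xs ≡ ∑ xs (λ _ → 1)
    length≡∑1 xs = trans (sym (*-identityʳ _)) (sym (∑-const xs 1))

    ∑-≤-const : ∀ (xs : List A) {f : A → ℕ} {c} → (∀ {x} → x ∈ xs → f x ≤ c) → ∑ xs f ≤ length xs * c
    ∑-≤-const xs h = ≤-trans (∑-mono-∈ xs h) (≤-reflexive (∑-const xs _))

    ∑-map : ∀ {B : Set b} (xs : List B) (h : B → A) (f : A → ℕ) → ∑ (map h xs) f ≡ ∑ xs (f ∘ h)
    ∑-map xs h f = cong sum (sym (map-∘ xs))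

    ∑-++ : ∀ (xs ys : List A) (f : A → ℕ) → ∑ (xs ++ ys) f ≡ ∑ xs f + ∑ ys f
    ∑-++ xs ys f = trans (cong sum (map-++ f xs ys)) (sum-++ (map f xs) (map f ys))

    ∑-filter : ∀ {P : A → Set ℓ} (P? : ∀ x → Dec (P x)) (xs : List A) (f : A → ℕ) →
               ∑ (filter P? xs) f ≡ ∑ xs (λ x → 𝟙 (P? x) * f x)
    ∑-filter P? [] f = refl
    ∑-filter P? (x ∷ xs) f with does (P? x)
    ... | true  = cong₂ _+_ (sym (+-identityʳ (f x))) (∑-filter P? xs f)
    ... | false = ∑-filter P? xs f

    length-filter≡∑ : ∀ {P : A → Set ℓ} (P? : ∀ x → Dec (P x)) (xs : List A) →
                      length (filter P? xs) ≡ ∑ xs (λ x → 𝟙 (P? x))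
    length-filter≡∑ P? xs = trans (length≡∑1 (filter P? xs))
      (trans (∑-filter P? xs _) (∑-cong-∈ xs λ {x} _ → *-identityʳ (𝟙 (P? x))))

    -- The entries of `xs` are cut out of `ys` one at a time, so no decidable equality is needed and
    -- `ys` may have repetitions.
    unique⊆⇒↭ : ∀ {xs ys : List A} → Unique xs → (∀ {x} → x ∈ xs → x ∈ ys) → ∃[ zs ] ys ↭ xs ++ zs
    unique⊆⇒↭ {[]} {ys} _ _ = ys , ↭-refl
    unique⊆⇒↭ {x ∷ xs} (x∉ ∷ u) sub with ∈-∃++ (sub (here refl))
    ... | ls , rs , refl with unique⊆⇒↭ {xs} {ls ++ rs} u sub′
      where
      sub′ : ∀ {y} → y ∈ xs → y ∈ ls ++ rs
      sub′ y∈ with ∈-resp-↭ (shift x ls rs) (sub (there y∈))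
      ... | here refl  = contradiction refl (All.lookup x∉ y∈)
      ... | there y∈′ = y∈′
    ... | zs , perm = zs , ↭-trans (shift x ls rs) (prep x perm)

    ∑-unique-⊆ : ∀ {xs ys : List A} → Unique xs → (∀ {x} → x ∈ xs → x ∈ ys) → (f : A → ℕ) → ∑ xs f ≤ ∑ ys f
    ∑-unique-⊆ {xs} {ys} u sub f with unique⊆⇒↭ u sub
    ... | zs , perm = begin
      ∑ xs f             ≤⟨ m≤m+n _ _ ⟩
      ∑ xs f + ∑ zs f    ≡⟨ ∑-++ xs zs f ⟨
      ∑ (xs ++ zs) f     ≡⟨ sum-↭ (map⁺ f perm) ⟨
      ∑ ys f             ∎
      where open ≤-Reasoning

    length-unique-⊆ : ∀ {xs ys : List A} → Unique xs → (∀ {x} → x ∈ xs → x ∈ ys) → length xs ≤ length ys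
    length-unique-⊆ {xs} {ys} u sub = subst₂ _≤_ (sym (length≡∑1 xs)) (sym (length≡∑1 ys)) (∑-unique-⊆ u sub _)

  ∑-comm : ∀ (xs : List A) (ys : List B) (f : A → B → ℕ) →
           ∑ xs (λ x → ∑ ys (f x)) ≡ ∑ ys (λ y → ∑ xs (λ x → f x y))
  ∑-comm [] ys f = sym (trans (∑-const ys 0) (*-zeroʳ (length ys)))
  ∑-comm (x ∷ xs) ys f = trans (cong (∑ ys (f x) +_) (∑-comm xs ys f)) (sym (∑-distrib-+ ys (f x) _))

  -- Shadows and levels

  shadow : Subset n → List (Subset n)
  shadow []            = []
  shadow (outside ∷ B) = map (outside ∷_) (shadow B)
  shadow (inside ∷ B)  = (outside ∷ B) ∷ map (inside ∷_) (shadow B)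

  length-shadow : (B : Subset n) → length (shadow B) ≡ ∣ B ∣
  length-shadow []            = refl
  length-shadow (outside ∷ B) = trans (length-map _ (shadow B)) (length-shadow B)
  length-shadow (inside ∷ B)  = cong suc (trans (length-map _ (shadow B)) (length-shadow B))

  shadow-unique : (B : Subset n) → Unique (shadow B)
  shadow-unique []            = []
  shadow-unique (outside ∷ B) = Unique.map⁺ ∷-injectiveʳ (shadow-unique B)
  shadow-unique (inside ∷ B)  = All.tabulate fresh ∷ Unique.map⁺ ∷-injectiveʳ (shadow-unique B)
    where
    fresh : ∀ {A} → A ∈ map (inside ∷_) (shadow B) → outside ∷ B ≢ A
    fresh A∈ refl with ∈-map⁻ (inside ∷_) A∈
    ... | _ , _ , ()

  ∈-shadow⁻ : (B : Subset n) {A : Subset n} → A ∈ shadow B → A ⊂ B × suc ∣ A ∣ ≡ ∣ B ∣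
  ∈-shadow⁻ (outside ∷ B) A∈ with ∈-map⁻ _ A∈
  ... | A′ , A′∈ , refl = s⊂s (proj₁ (∈-shadow⁻ B A′∈)) , proj₂ (∈-shadow⁻ B A′∈)
  ∈-shadow⁻ (inside ∷ B) (here refl) = out⊂in ⊆-refl , refl
  ∈-shadow⁻ (inside ∷ B) (there A∈) with ∈-map⁻ _ A∈
  ... | A′ , A′∈ , refl = s⊂s (proj₁ (∈-shadow⁻ B A′∈)) , cong suc (proj₂ (∈-shadow⁻ B A′∈))

  level : (n b : ℕ) → List (Subset n)
  level zero    zero    = [] ∷ []
  level zero    (suc b) = []
  level (suc n) zero    = map (outside ∷_) (level n zero)
  level (suc n) (suc b) = map (outside ∷_) (level n (suc b)) ++ map (inside ∷_) (level n b)

  ∈-level⁺ : (B : Subset n) → B ∈ level n ∣ B ∣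
  ∈-level⁺ []            = here refl
  ∈-level⁺ (inside ∷ B)  = ∈-++⁺ʳ _ (∈-map⁺ _ (∈-level⁺ B))
  ∈-level⁺ (outside ∷ B) with ∣ B ∣ | ∈-level⁺ B
  ... | zero  | B∈ = ∈-map⁺ _ B∈
  ... | suc b | B∈ = ∈-++⁺ˡ (∈-map⁺ _ B∈)

  ∈-level⁻ : ∀ n b {B : Subset n} → B ∈ level n b → ∣ B ∣ ≡ b
  ∈-level⁻ zero    zero    (here refl) = refl
  ∈-level⁻ (suc n) zero    B∈ with ∈-map⁻ _ B∈
  ... | _ , B′∈ , refl = ∈-level⁻ n zero B′∈
  ∈-level⁻ (suc n) (suc b) B∈ with ∈-++⁻ (map (outside ∷_) (level n (suc b))) B∈
  ... | inj₁ B∈₁ with ∈-map⁻ _ B∈₁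
  ...   | _ , B′∈ , refl = ∈-level⁻ n (suc b) B′∈
  ∈-level⁻ (suc n) (suc b) B∈ | inj₂ B∈₂ with ∈-map⁻ _ B∈₂
  ...   | _ , B′∈ , refl = cong suc (∈-level⁻ n b B′∈)

  length-level : ∀ n b → length (level n b) ≡ n C b
  length-level zero    zero    = refl
  length-level zero    (suc b) = sym (k>n⇒nCk≡0 {0} {suc b} z<s)
  length-level (suc n) zero    = trans (length-map _ (level n 0)) (trans (length-level n 0) (trans (nC0≡1 n) (sym (nC0≡1 (suc n)))))
    where
    nC0≡1 : ∀ n → n C 0 ≡ 1
    nC0≡1 n = trans (nCk≡nC[n∸k] {0} {n} z≤n) (nCn≡1 n)
  length-level (suc n) (suc b) = begin
    length (map (outside ∷_) (level n (suc b)) ++ map (inside ∷_) (level n b))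
      ≡⟨ length-++ (map (outside ∷_) (level n (suc b))) ⟩
    length (map (outside ∷_) (level n (suc b))) + length (map (inside ∷_) (level n b))
      ≡⟨ cong₂ _+_ (trans (length-map _ (level n (suc b))) (length-level n (suc b)))
                   (trans (length-map _ (level n b)) (length-level n b)) ⟩
    n C suc b + n C b
      ≡⟨ +-comm (n C suc b) (n C b) ⟩
    n C b + n C suc b
      ≡⟨ nCk+nC[k+1]≡[n+1]C[k+1] n b ⟩
    suc n C suc b ∎
    where open ≡-Reasoning

  ∑-level-suc : ∀ n b (g : Subset (suc n) → ℕ) →
    ∑ (level (suc n) (suc b)) g ≡ ∑ (level n (suc b)) (g ∘ (outside ∷_)) + ∑ (level n b) (g ∘ (inside ∷_))
  ∑-level-suc n b g = trans (∑-++ (map (outside ∷_) (level n (suc b))) _ g)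
    (cong₂ _+_ (∑-map (level n (suc b)) _ g) (∑-map (level n b) _ g))

  ∑-level-empty : ∀ {n b} → n < b → (g : Subset n → ℕ) → ∑ (level n b) g ≡ 0
  ∑-level-empty {n} {b} n<b g with level n b | trans (length-level n b) (k>n⇒nCk≡0 n<b)
  ... | [] | _ = refl

  -- Double counting of cover pairs: a set of size `b` has `n ∸ b` covers. In the induction on `n`,
  -- a set avoiding the first element gains one cover, by adding that element; for a set containing
  -- it both dimension and size grow by one.
  ∑-level-shadow : ∀ n b (g : Subset n → ℕ) →
    ∑ (level n (suc b)) (λ B → ∑ (shadow B) g) ≡ (n ∸ b) * ∑ (level n b) g
  ∑-level-shadow zero    zero    g = refl
  ∑-level-shadow zero    (suc b) g = refl
  ∑-level-shadow (suc n) b       g = begin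
    ∑ (level (suc n) (suc b)) (λ B → ∑ (shadow B) g)
      ≡⟨ ∑-level-suc n b (λ B → ∑ (shadow B) g) ⟩
    ∑ (level n (suc b)) (λ B → ∑ (shadow (outside ∷ B)) g) + ∑ (level n b) (λ B → ∑ (shadow (inside ∷ B)) g)
      ≡⟨ cong₂ _+_ (∑-cong-∈ (level n (suc b)) λ {B} _ → ∑-map (shadow B) _ g)
                   (∑-cong-∈ (level n b) λ {B} _ → cong (g (outside ∷ B) +_) (∑-map (shadow B) _ g)) ⟩
    ∑ (level n (suc b)) (λ B → ∑ (shadow B) g₀) + ∑ (level n b) (λ B → g₀ B + ∑ (shadow B) g₁)
      ≡⟨ cong₂ _+_ (∑-level-shadow n b g₀) (∑-distrib-+ (level n b) g₀ _) ⟩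
    (n ∸ b) * ∑ (level n b) g₀ + (∑ (level n b) g₀ + ∑ (level n b) (λ B → ∑ (shadow B) g₁))
      ≡⟨ split b ⟩
    (suc n ∸ b) * ∑ (level (suc n) b) g ∎
    where
    open ≡-Reasoning
    g₀ = g ∘ (outside ∷_)
    g₁ = g ∘ (inside ∷_)
    factor : ∀ k x y → k * x + (x + suc k * y) ≡ suc k * (x + y)
    factor = solve-∀
    split : ∀ b → (n ∸ b) * ∑ (level n b) g₀ + (∑ (level n b) g₀ + ∑ (level n b) (λ B → ∑ (shadow B) g₁))
            ≡ (suc n ∸ b) * ∑ (level (suc n) b) g
    split zero = begin
      n * ∑ (level n 0) g₀ + (∑ (level n 0) g₀ + ∑ (level n 0) (λ B → ∑ (shadow B) g₁))
        ≡⟨ cong (λ z → n * ∑ (level n 0) g₀ + (∑ (level n 0) g₀ + z)) (bottom n g₁) ⟩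
      n * ∑ (level n 0) g₀ + (∑ (level n 0) g₀ + 0)
        ≡⟨ lemma n _ ⟩
      suc n * ∑ (level n 0) g₀
        ≡⟨ cong (suc n *_) (∑-map (level n 0) _ g) ⟨
      suc n * ∑ (level (suc n) 0) g ∎
      where
      lemma : ∀ n x → n * x + (x + 0) ≡ suc n * x
      lemma = solve-∀
      bottom : ∀ n (h : Subset n → ℕ) → ∑ (level n 0) (λ B → ∑ (shadow B) h) ≡ 0
      bottom zero    h = refl
      bottom (suc n) h = trans (∑-map (level n 0) _ (λ B → ∑ (shadow B) h))
        (trans (∑-cong-∈ (level n 0) λ {B} _ → ∑-map (shadow B) _ h) (bottom n (h ∘ (outside ∷_))))
    -- Subtraction is truncated: `n ∸ b` is a successor only for `b < n`. Otherwise level `suc b` is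
    -- empty and its sum vanishes.
    split (suc b) with suc b ≤? n
    ... | yes b<n = begin
      (n ∸ suc b) * x + (x + ∑ (level n (suc b)) (λ B → ∑ (shadow B) g₁))
        ≡⟨ cong (λ z → (n ∸ suc b) * x + (x + z)) (∑-level-shadow n b g₁) ⟩
      (n ∸ suc b) * x + (x + (n ∸ b) * y)
        ≡⟨ cong (λ z → (n ∸ suc b) * x + (x + z * y)) n∸b ⟩
      (n ∸ suc b) * x + (x + suc (n ∸ suc b) * y)
        ≡⟨ factor (n ∸ suc b) x y ⟩
      suc (n ∸ suc b) * (x + y)
        ≡⟨ cong₂ _*_ n∸b (∑-level-suc n b g) ⟨
      (n ∸ b) * ∑ (level (suc n) (suc b)) g ∎
      where
      x = ∑ (level n (suc b)) g₀
      y = ∑ (level n b) g₁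
      n∸b : n ∸ b ≡ suc (n ∸ suc b)
      n∸b = +-∸-assoc 1 b<n
    ... | no b≮n = begin
      (n ∸ suc b) * x + (x + ∑ (level n (suc b)) (λ B → ∑ (shadow B) g₁))
        ≡⟨ cong₂ (λ u v → (n ∸ suc b) * u + (u + v)) (∑-level-empty (≰⇒> b≮n) g₀) (∑-level-shadow n b g₁) ⟩
      (n ∸ suc b) * 0 + (n ∸ b) * y
        ≡⟨ cong (_+ (n ∸ b) * y) (*-zeroʳ (n ∸ suc b)) ⟩
      (n ∸ b) * y
        ≡⟨ cong (λ u → (n ∸ b) * (u + y)) (∑-level-empty (≰⇒> b≮n) g₀) ⟨
      (n ∸ b) * (x + y)
        ≡⟨ cong ((n ∸ b) *_) (∑-level-suc n b g) ⟨
      (n ∸ b) * ∑ (level (suc n) (suc b)) g ∎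
      where
      x = ∑ (level n (suc b)) g₀
      y = ∑ (level n b) g₁

  _≟ˢ_ : ∀ {n} (A B : Subset n) → Dec (A ≡ B)
  _≟ˢ_ = ≡-dec Bool._≟_

  -- The cover pairs between two levels, counted from both ends; above the middle this gives the
  -- fraction of walkers that move on.
  suc*C : ∀ n b → suc b * (n C suc b) ≡ (n ∸ b) * (n C b)
  suc*C n b = begin
    suc b * (n C suc b)
      ≡⟨ cong (suc b *_) (length-level n (suc b)) ⟨
    suc b * length (level n (suc b))
      ≡⟨ *-comm (suc b) _ ⟩
    length (level n (suc b)) * suc b
      ≡⟨ ∑-const (level n (suc b)) (suc b) ⟨
    ∑ (level n (suc b)) (λ _ → suc b)
      ≡⟨ ∑-cong-∈ (level n (suc b)) (λ {B} B∈ → trans (sym (∈-level⁻ n (suc b) B∈))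
           (trans (sym (length-shadow B)) (length≡∑1 (shadow B)))) ⟩
    ∑ (level n (suc b)) (λ B → ∑ (shadow B) (λ _ → 1))
      ≡⟨ ∑-level-shadow n b (λ _ → 1) ⟩
    (n ∸ b) * ∑ (level n b) (λ _ → 1)
      ≡⟨ cong ((n ∸ b) *_) (trans (sym (length≡∑1 (level n b))) (length-level n b)) ⟩
    (n ∸ b) * (n C b) ∎
    where open ≡-Reasoning

  -- Comparable pairs

  cumulative : (ℕ → ℕ) → ℕ → ℕ
  cumulative f zero    = f 0
  cumulative f (suc b) = cumulative f b + f (suc b)

  cumulative-+ : ∀ f g b → cumulative (λ i → f i + g i) b ≡ cumulative f b + cumulative g b
  cumulative-+ f g zero    = refl
  cumulative-+ f g (suc b) = trans (cong (_+ (f (suc b) + g (suc b))) (cumulative-+ f g b))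
    (lemma (cumulative f b) (cumulative g b) (f (suc b)) (g (suc b)))
    where
    lemma : ∀ p q r s → p + q + (r + s) ≡ p + r + (q + s)
    lemma = solve-∀

  cumulative-0 : ∀ b → cumulative (λ _ → 0) b ≡ 0
  cumulative-0 zero    = refl
  cumulative-0 (suc b) = trans (+-identityʳ _) (cumulative-0 b)

  cumulative-< : ∀ {a} x b → b < a → cumulative (λ i → 𝟙 (a ≟ i) * x) b ≡ 0
  cumulative-< {a} x zero    b<a = cong (_* x) (𝟙-no (a ≟ 0) (>⇒≢ b<a))
  cumulative-< {a} x (suc b) b<a = cong₂ _+_ (cumulative-< x b (<-trans (n<1+n b) b<a)) (cong (_* x) (𝟙-no (a ≟ suc b) (>⇒≢ b<a)))

  cumulative-≡ : ∀ {a} x b → a ≤ b → cumulative (λ i → 𝟙 (a ≟ i) * x) b ≡ x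
  cumulative-≡ {a} x b a≤b with m≤n⇒m<n∨m≡n a≤b
  cumulative-≡ {zero}  x zero    a≤b | _ = +-identityʳ x
  cumulative-≡ {suc a} x zero    ()  | _
  cumulative-≡ {a}     x (suc b) a≤b | inj₁ a<1+b =
    trans (cong₂ _+_ (cumulative-≡ x b (s≤s⁻¹ a<1+b)) (cong (_* x) (𝟙-no (a ≟ suc b) (<⇒≢ a<1+b)))) (+-identityʳ x)
  cumulative-≡ {a}     x (suc b) a≤b | inj₂ refl =
    cong₂ _+_ (cumulative-< x b ≤-refl) (trans (cong (_* x) (𝟙-yes (a ≟ a) refl)) (+-identityʳ x))

  cumulative-by-size : ∀ {n} (F : List (Subset n)) (g : Subset n → ℕ) →
    cumulative (λ b → ∑ F (λ B → 𝟙 (∣ B ∣ ≟ b) * g B)) n ≡ ∑ F g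
  cumulative-by-size {n} []      g = cumulative-0 n
  cumulative-by-size {n} (B ∷ F) g = trans (cumulative-+ _ _ n)
    (cong₂ _+_ (cumulative-≡ (g B) n (∣p∣≤n B)) (cumulative-by-size F g))

  -- With s = k + j, a fraction k / s of the walkers at a level moves on and j / s stops there; moving the
  -- latter to the left-hand side avoids subtraction.
  upper-step : ∀ {s F L L′ M W W′ V′ E c} N k j f e →
    s ≡ k + j → s * L′ ≡ k * L → V′ ≡ k * W → W ≤ L * c →
    N * (c * F) + N * (c * L) ≤ N * (c * M) + N * W + 2 * (c * E) →
    N * V′ + N * (s * c * f) ≤ N * W′ + 2 * (s * c * e) →
    N * (s * c * (F + f)) + N * (s * c * L′) ≤ N * (s * c * M) + N * W′ + 2 * (s * c * (E + e))
  upper-step {s} {F} {L} {L′} {M} {W} {W′} {_} {E} {c} N k j f e refl sC′ refl W≤ below now =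
    +-cancelˡ-≤ (N * (k * W) + N * (j * (L * c))) _ _ (begin
      N * (k * W) + N * (j * (L * c)) + (N * (s * c * (F + f)) + N * (s * c * L′))
        ≡⟨ cong (λ z → N * (k * W) + N * (j * (L * c)) + (N * (s * c * (F + f)) + N * z))
             (trans (push s c L′) (cong (c *_) sC′)) ⟩
      N * (k * W) + N * (j * (L * c)) + (N * (s * c * (F + f)) + N * (c * (k * L)))
        ≡⟨ lhs N k j c F f L W ⟩
      s * (N * (c * F) + N * (c * L)) + (N * (k * W) + N * (s * c * f))
        ≤⟨ +-mono-≤ (*-monoʳ-≤ s below) now ⟩
      s * (N * (c * M) + N * W + 2 * (c * E)) + (N * W′ + 2 * (s * c * e))
        ≡⟨ rhs N k j c M W W′ E e ⟩
      N * (j * W) + (N * (k * W) + (N * (s * c * M) + N * W′ + 2 * (s * c * (E + e))))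
        ≤⟨ +-monoˡ-≤ _ (*-monoʳ-≤ N (*-monoʳ-≤ j W≤)) ⟩
      N * (j * (L * c)) + (N * (k * W) + (N * (s * c * M) + N * W′ + 2 * (s * c * (E + e))))
        ≡⟨ rotate (N * (j * (L * c))) (N * (k * W)) _ ⟩
      N * (k * W) + N * (j * (L * c)) + (N * (s * c * M) + N * W′ + 2 * (s * c * (E + e))) ∎)
    where
    open ≤-Reasoning
    push : ∀ s c x → s * c * x ≡ c * (s * x)
    push = solve-∀
    lhs : ∀ N k j c F f L W → N * (k * W) + N * (j * (L * c)) + (N * ((k + j) * c * (F + f)) + N * (c * (k * L)))
        ≡ (k + j) * (N * (c * F) + N * (c * L)) + (N * (k * W) + N * ((k + j) * c * f))
    lhs = solve-∀
    rhs : ∀ N k j c M W W′ E e → (k + j) * (N * (c * M) + N * W + 2 * (c * E)) + (N * W′ + 2 * ((k + j) * c * e))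
        ≡ N * (j * W) + (N * (k * W) + (N * ((k + j) * c * M) + N * W′ + 2 * ((k + j) * c * (E + e))))
    rhs = solve-∀
    rotate : ∀ x y z → x + (y + z) ≡ y + x + z
    rotate = solve-∀

  module Comparabilities {n : ℕ} (F : List (Subset n)) (F! : Unique F) where

    open DecMembership (_≟ˢ_ {n}) using (_∈?_)

    down : Subset n → ℕ
    down B = ∑ F (λ A → 𝟙 (A ⊂? B))

    stay : ℕ → ℕ
    stay b = (n ∸ b) ⊔ suc b

    -- The common denominator of all walk masses at level `b`.
    scale : ℕ → ℕ
    scale zero    = 1
    scale (suc b) = stay b * scale b

    scale>0 : ∀ b → 0 < scale b
    scale>0 zero    = z<s
    scale>0 (suc b) = *-mono-≤ (≤-trans (s≤s z≤n) (m≤n⊔m (n ∸ b) (suc b))) (scale>0 b)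

    -- A walker at level b steps to each superset of size b + 1 with probability 1 / stay b. The masses at
    -- level b of the walkers that have hit F strictly below a set, or at or below it, are before b / scale b
    -- and after b / scale b.
    mutual
      before : ℕ → Subset n → ℕ
      before zero    B = 0
      before (suc b) B = ∑ (shadow B) (after b)

      after : ℕ → Subset n → ℕ
      after b A = if does (A ∈? F) then scale b else before b A

    mutual
      -- A set of size `suc b` receives at most `1 / stay b` from each of `suc b` subsets, and
      -- `suc b ≤ stay b`.
      before≤scale : ∀ b {B} → ∣ B ∣ ≡ b → before b B ≤ scale b
      before≤scale zero    eq = z≤n
      before≤scale (suc b) {B} eq = begin
        ∑ (shadow B) (after b)       ≤⟨ ∑-≤-const (shadow B) (λ A∈ →
                                          after≤scale b (suc-injective (trans (proj₂ (∈-shadow⁻ B A∈)) eq))) ⟩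
        length (shadow B) * scale b  ≡⟨ cong (_* scale b) (trans (length-shadow B) eq) ⟩
        suc b * scale b              ≤⟨ *-monoˡ-≤ (scale b) (m≤n⊔m (n ∸ b) (suc b)) ⟩
        stay b * scale b             ∎
        where open ≤-Reasoning

      after≤scale : ∀ b {A} → ∣ A ∣ ≡ b → after b A ≤ scale b
      after≤scale b {A} eq with does (A ∈? F)
      ... | true  = ≤-refl
      ... | false = before≤scale b eq

    after-∈ : ∀ b {A} → A ∈ F → after b A ≡ scale b
    after-∈ b {A} A∈ with A ∈? F
    ... | yes _  = refl
    ... | no A∉ = contradiction A∈ A∉

    before≤after : ∀ b {B} → ∣ B ∣ ≡ b → before b B ≤ after b B
    before≤after b {B} eq with does (B ∈? F)
    ... | true  = before≤scale b eq
    ... | false = ≤-refl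

    -- The two arguments of the maximum add up to at least `n + 1`.
    1+n≤2*stay : ∀ b → suc n ≤ 2 * stay b
    1+n≤2*stay b = begin
      suc n                  ≤⟨ s≤s (m≤n+m∸n n b) ⟩
      suc (b + (n ∸ b))      ≡⟨ +-comm (suc b) (n ∸ b) ⟩
      (n ∸ b) + suc b        ≤⟨ +-mono-≤ (m≤m⊔n (n ∸ b) (suc b)) (m≤n⊔m (n ∸ b) (suc b)) ⟩
      stay b + stay b        ≡⟨ cong (stay b +_) (+-identityʳ (stay b)) ⟨
      2 * stay b             ∎
      where open ≤-Reasoning

    -- For `∣ B ∣ = suc b` this counts the members of `F` below `B` but outside its shadow: one
    -- bound for `down A` valid for every `A` in the shadow.
    deepDown : ℕ → Subset n → ℕ
    deepDown b B = ∑ F (λ A → 𝟙 (A ⊂? B ×-dec ∣ A ∣ <? b))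

    down≤deepDown : ∀ {b A B} → ∣ A ∣ ≡ b → A ⊂ B → down A ≤ deepDown b B
    down≤deepDown {_} {A} {B} refl A⊂B = ∑-mono F λ X →
      𝟙-mono (λ X⊂A → ⊂-trans X⊂A A⊂B , p⊂q⇒∣p∣<∣q∣ X⊂A) (X ⊂? A) (X ⊂? B ×-dec ∣ X ∣ <? ∣ A ∣)

    shadow∩F+deepDown≤down : ∀ {b} B → ∣ B ∣ ≡ suc b → ∑ (shadow B) (λ A → 𝟙 (A ∈? F)) + deepDown b B ≤ down B
    shadow∩F+deepDown≤down {b} B eq = begin
      ∑ (shadow B) (λ A → 𝟙 (A ∈? F)) + deepDown b B
        ≡⟨ cong (_+ deepDown b B) (length-filter≡∑ (_∈? F) (shadow B)) ⟨
      length S + deepDown b B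
        ≡⟨ cong (_+ deepDown b B) (length≡∑1 S) ⟩
      ∑ S (λ _ → 1) + deepDown b B
        ≡⟨ cong (_+ deepDown b B) (∑-cong-∈ S λ {A} A∈ → sym (𝟙-yes (cover? A) (covered (proj₁ (∈-filter⁻ (_∈? F) A∈))))) ⟩
      ∑ S (λ A → 𝟙 (cover? A)) + deepDown b B
        ≤⟨ +-monoˡ-≤ (deepDown b B) (∑-unique-⊆ (Unique.filter⁺ (_∈? F) (shadow-unique B)) (λ A∈ → proj₂ (∈-filter⁻ (_∈? F) {xs = shadow B} A∈)) _) ⟩
      ∑ F (λ A → 𝟙 (cover? A)) + deepDown b B
        ≡⟨ ∑-distrib-+ F _ _ ⟨
      ∑ F (λ A → 𝟙 (cover? A) + 𝟙 (A ⊂? B ×-dec ∣ A ∣ <? b))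
        ≤⟨ ∑-mono F split ⟩
      down B ∎
      where
      open ≤-Reasoning
      S = filter (_∈? F) (shadow B)
      cover? : ∀ A → Dec (A ⊂ B × ∣ A ∣ ≡ b)
      cover? A = A ⊂? B ×-dec ∣ A ∣ ≟ b
      covered : ∀ {A} → A ∈ shadow B → A ⊂ B × ∣ A ∣ ≡ b
      covered A∈ = proj₁ (∈-shadow⁻ B A∈) , suc-injective (trans (proj₂ (∈-shadow⁻ B A∈)) eq)
      split : ∀ A → 𝟙 (cover? A) + 𝟙 (A ⊂? B ×-dec ∣ A ∣ <? b) ≤ 𝟙 (A ⊂? B)
      split A = 𝟙-disjoint proj₁ proj₁ (λ (_ , ∣A∣≡b) (_ , ∣A∣<b) → <⇒≢ ∣A∣<b ∣A∣≡b) (cover? A) (A ⊂? B ×-dec ∣ A ∣ <? b) (A ⊂? B)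

    -- Induction on the level. A shadow set in `F` sends mass `1 / stay b`, at most 2 / (n + 1),
    -- charged to that one pair. A shadow set outside `F` sends on what hit `F` below it, bounded
    -- inductively through `deepDown`. The shadow sets have total weight at most 1, so each deeper
    -- member is charged only once.
    before≤down : ∀ b {B} → ∣ B ∣ ≡ b → suc n * before b B ≤ 2 * (scale b * down B)
    before≤down zero        eq = ≤-trans (≤-reflexive (*-zeroʳ (suc n))) z≤n
    before≤down (suc b) {B} eq = begin
      suc n * ∑ (shadow B) (after b)
        ≡⟨ *-distribˡ-∑ (shadow B) (suc n) (after b) ⟩
      ∑ (shadow B) (λ A → suc n * after b A)
        ≤⟨ ∑-mono-∈ (shadow B) step ⟩
      ∑ (shadow B) (λ A → 2 * scale (suc b) * 𝟙 (A ∈? F) + 2 * (scale b * deepDown b B))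
        ≡⟨ ∑-distrib-+ (shadow B) _ _ ⟩
      ∑ (shadow B) (λ A → 2 * scale (suc b) * 𝟙 (A ∈? F)) + ∑ (shadow B) (λ A → 2 * (scale b * deepDown b B))
        ≡⟨ cong₂ _+_ (*-distribˡ-∑ (shadow B) (2 * scale (suc b)) (λ A → 𝟙 (A ∈? F))) (sym (∑-const (shadow B) _)) ⟨
      2 * scale (suc b) * hits + length (shadow B) * (2 * (scale b * deepDown b B))
        ≤⟨ +-monoʳ-≤ (2 * scale (suc b) * hits) (*-monoˡ-≤ (2 * (scale b * deepDown b B))
             (≤-trans (≤-reflexive (trans (length-shadow B) eq)) (m≤n⊔m (n ∸ b) (suc b)))) ⟩
      2 * scale (suc b) * hits + stay b * (2 * (scale b * deepDown b B))
        ≡⟨ collect (stay b) (scale b) hits (deepDown b B) ⟩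
      2 * (scale (suc b) * (hits + deepDown b B))
        ≤⟨ *-monoʳ-≤ 2 (*-monoʳ-≤ (scale (suc b)) (shadow∩F+deepDown≤down B eq)) ⟩
      2 * (scale (suc b) * down B) ∎
      where
      open ≤-Reasoning
      hits = ∑ (shadow B) (λ A → 𝟙 (A ∈? F))
      collect : ∀ s c h d → 2 * (s * c) * h + s * (2 * (c * d)) ≡ 2 * (s * c * (h + d))
      collect = solve-∀
      reorder : ∀ s c → 2 * s * c ≡ 2 * (s * c) * 1
      reorder = solve-∀
      step : ∀ {A} → A ∈ shadow B → suc n * after b A ≤ 2 * scale (suc b) * 𝟙 (A ∈? F) + 2 * (scale b * deepDown b B)
      step {A} A∈ with does (A ∈? F)
      ... | true  = begin
        suc n * scale b                ≤⟨ *-monoˡ-≤ (scale b) (1+n≤2*stay b) ⟩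
        2 * stay b * scale b           ≡⟨ reorder (stay b) (scale b) ⟩
        2 * scale (suc b) * 1          ≤⟨ m≤m+n (2 * scale (suc b) * 1) _ ⟩
        2 * scale (suc b) * 1 + 2 * (scale b * deepDown b B) ∎
      ... | false = begin
        suc n * before b A             ≤⟨ before≤down b ∣A∣ ⟩
        2 * (scale b * down A)         ≤⟨ *-monoʳ-≤ 2 (*-monoʳ-≤ (scale b) (down≤deepDown ∣A∣ (proj₁ (∈-shadow⁻ B A∈)))) ⟩
        2 * (scale b * deepDown b B)   ≤⟨ m≤n+m _ (2 * scale (suc b) * 0) ⟩
        2 * scale (suc b) * 0 + 2 * (scale b * deepDown b B) ∎
        where
        ∣A∣ = suc-injective (trans (proj₂ (∈-shadow⁻ B A∈)) eq)

    outflow : ℕ → ℕ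
    outflow b = ∑ (level n b) (after b)

    inflow : ℕ → ℕ
    inflow b = ∑ (level n b) (before b)

    size-∑ : (Subset n → ℕ) → ℕ → ℕ
    size-∑ g b = ∑ F (λ B → 𝟙 (∣ B ∣ ≟ b) * g B)

    -- The unit mass at a member of `F` splits into first visits `new` and repeated visits `before`.
    -- First visits sum to at most outflow minus inflow; repeated visits are bounded by
    -- `before≤down`.
    flux : ∀ b → suc n * inflow b + suc n * (scale b * size-∑ (λ _ → 1) b)
               ≤ suc n * outflow b + 2 * (scale b * size-∑ down b)
    flux b = begin
      suc n * inflow b + suc n * (scale b * size-∑ (λ _ → 1) b)
        ≡⟨ cong (λ z → suc n * inflow b + suc n * z) (scaled (λ _ → 1)) ⟩
      suc n * inflow b + suc n * ∑ Fb (λ _ → scale b * 1)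
        ≡⟨ cong (λ z → suc n * inflow b + suc n * z) (∑-cong-∈ Fb newly) ⟩
      suc n * inflow b + suc n * ∑ Fb (λ B → new B + before b B)
        ≡⟨ cong (λ z → suc n * inflow b + suc n * z) (∑-distrib-+ Fb new (before b)) ⟩
      suc n * inflow b + suc n * (∑ Fb new + ∑ Fb (before b))
        ≡⟨ regroup (suc n) (inflow b) (∑ Fb new) (∑ Fb (before b)) ⟩
      suc n * (inflow b + ∑ Fb new) + suc n * ∑ Fb (before b)
        ≤⟨ +-mono-≤ (*-monoʳ-≤ (suc n) (+-monoʳ-≤ (inflow b) (∑-unique-⊆ (Unique.filter⁺ size? F!) Fb⊆level new)))
                    (≤-trans (≤-reflexive (*-distribˡ-∑ Fb (suc n) (before b))) (∑-mono-∈ Fb λ B∈ → before≤down b (∈Fb B∈))) ⟩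
      suc n * (inflow b + ∑ (level n b) new) + ∑ Fb (λ B → 2 * (scale b * down B))
        ≡⟨ cong₂ (λ y z → suc n * y + z) whole (trans (sym (*-distribˡ-∑ Fb 2 _)) (cong (2 *_) (sym (scaled down)))) ⟩
      suc n * outflow b + 2 * (scale b * size-∑ down b) ∎
      where
      open ≤-Reasoning
      size? : ∀ B → Dec (∣ B ∣ ≡ b)
      size? B = ∣ B ∣ ≟ b
      Fb = filter size? F
      ∈Fb : ∀ {B} → B ∈ Fb → ∣ B ∣ ≡ b
      ∈Fb B∈ = proj₂ (∈-filter⁻ size? {xs = F} B∈)
      Fb⊆level : ∀ {B} → B ∈ Fb → B ∈ level n b
      Fb⊆level {B} B∈ = subst (λ c → B ∈ level n c) (∈Fb B∈) (∈-level⁺ B)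
      new : Subset n → ℕ
      new B = after b B ∸ before b B
      newly : ∀ {B} → B ∈ Fb → scale b * 1 ≡ new B + before b B
      newly {B} B∈ = trans (*-identityʳ (scale b)) (trans (sym (after-∈ b (proj₁ (∈-filter⁻ size? B∈))))
        (sym (m∸n+n≡m (before≤after b (∈Fb B∈)))))
      scaled : ∀ g → scale b * size-∑ g b ≡ ∑ Fb (λ B → scale b * g B)
      scaled g = trans (cong (scale b *_) (sym (∑-filter size? F g))) (*-distribˡ-∑ Fb (scale b) g)
      regroup : ∀ m i x y → m * i + m * (x + y) ≡ m * (i + x) + m * y
      regroup = solve-∀
      whole : inflow b + ∑ (level n b) new ≡ outflow b
      whole = trans (sym (∑-distrib-+ (level n b) _ _)) (∑-cong-∈ (level n b) λ B∈ → m+[n∸m]≡n (before≤after b (∈-level⁻ n b B∈)))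

    inflow-suc : ∀ b → inflow (suc b) ≡ (n ∸ b) * outflow b
    inflow-suc b = ∑-level-shadow n b (after b)

    outflow≤ : ∀ b → outflow b ≤ (n C b) * scale b
    outflow≤ b = ≤-trans (∑-≤-const (level n b) λ B∈ → after≤scale b (∈-level⁻ n b B∈))
      (≤-reflexive (cong (_* scale b) (length-level n b)))

    sizes downs : ℕ → ℕ
    sizes = cumulative (size-∑ (λ _ → 1))
    downs = cumulative (size-∑ down)

    2*⌊n/2⌋≤n : ⌊ n /2⌋ + ⌊ n /2⌋ ≤ n
    2*⌊n/2⌋≤n = ≤-trans (+-monoʳ-≤ ⌊ n /2⌋ (⌊n/2⌋≤⌈n/2⌉ n)) (≤-reflexive (⌊n/2⌋+⌈n/2⌉≡n n))

    n≤1+2*⌊n/2⌋ : n ≤ suc (⌊ n /2⌋ + ⌊ n /2⌋)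
    n≤1+2*⌊n/2⌋ = ≤-trans (≤-reflexive (sym (⌊n/2⌋+⌈n/2⌉≡n n)))
      (≤-trans (+-monoʳ-≤ ⌊ n /2⌋ (⌊n/2⌋-mono (n≤1+n (suc n)))) (≤-reflexive (+-suc _ _)))

    -- Below the middle `stay b` is `n ∸ b`: no walker stops, so after scaling the inflow of a level
    -- equals the outflow of the previous one and the `flux` inequalities telescope.
    lower-half : ∀ b → b ≤ ⌊ n /2⌋ → suc n * (scale b * sizes b) ≤ suc n * outflow b + 2 * (scale b * downs b)
    lower-half zero    b≤m = ≤-trans (m≤n+m _ (suc n * inflow zero)) (flux zero)
    lower-half (suc b) b<m = +-cancelˡ-≤ (suc n * inflow (suc b)) _ _ (begin
      N * inflow (suc b) + N * (scale (suc b) * (sizes b + f))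
        ≡⟨ split N (inflow (suc b)) (stay b) (scale b) (sizes b) f ⟩
      stay b * (N * (scale b * sizes b)) + (N * inflow (suc b) + N * (scale (suc b) * f))
        ≤⟨ +-mono-≤ (*-monoʳ-≤ (stay b) (lower-half b (<⇒≤ b<m))) (flux (suc b)) ⟩
      stay b * (N * outflow b + 2 * (scale b * downs b)) + (N * outflow (suc b) + 2 * (scale (suc b) * e))
        ≡⟨ merge N (stay b) (outflow b) (scale b) (downs b) (outflow (suc b)) e ⟩
      N * (stay b * outflow b) + (N * outflow (suc b) + 2 * (scale (suc b) * (downs b + e)))
        ≡⟨ cong (λ z → N * z + (N * outflow (suc b) + 2 * (scale (suc b) * (downs b + e))))
             (trans (cong (_* outflow b) stay≡) (sym (inflow-suc b))) ⟩
      N * inflow (suc b) + (N * outflow (suc b) + 2 * (scale (suc b) * (downs b + e))) ∎)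
      where
      open ≤-Reasoning
      N = suc n
      f = size-∑ (λ _ → 1) (suc b)
      e = size-∑ down (suc b)
      stay≡ : stay b ≡ n ∸ b
      stay≡ = m≥n⇒m⊔n≡m (m+n≤o⇒m≤o∸n (suc b) (≤-trans (+-mono-≤ b<m (<⇒≤ b<m)) 2*⌊n/2⌋≤n))
      split : ∀ N V s c F f → N * V + N * (s * c * (F + f)) ≡ s * (N * (c * F)) + (N * V + N * (s * c * f))
      split = solve-∀
      merge : ∀ N s W c E W′ e → s * (N * W + 2 * (c * E)) + (N * W′ + 2 * (s * c * e)) ≡ N * (s * W) + (N * W′ + 2 * (s * c * (E + e)))
      merge = solve-∀

    -- The difference `midBinom n - n C b` is the mass that stopped between the middle and level
    -- `b`; all of it is counted as having hit `F`. At the middle it is zero and `lower-half`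
    -- applies.
    upper-half : ∀ b → ⌊ n /2⌋ ≤ b → suc n * (scale b * sizes b) + suc n * (scale b * (n C b))
               ≤ suc n * (scale b * midBinom n) + suc n * outflow b + 2 * (scale b * downs b)
    upper-half b m≤b with m≤n⇒m<n∨m≡n m≤b
    ... | inj₂ refl = begin
      N * (scale b * sizes b) + N * (scale b * (n C b))
        ≤⟨ +-monoˡ-≤ (N * (scale b * (n C b))) (lower-half b ≤-refl) ⟩
      N * outflow b + 2 * (scale b * downs b) + N * (scale b * (n C b))
        ≡⟨ rotate (N * outflow b) (2 * (scale b * downs b)) (N * (scale b * (n C b))) ⟩
      N * (scale b * (n C b)) + N * outflow b + 2 * (scale b * downs b) ∎
      where
      open ≤-Reasoning
      N = suc n
      rotate : ∀ x y z → x + y + z ≡ z + x + y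
      rotate = solve-∀
    upper-half (suc b) _ | inj₁ m<1+b =
      upper-step (suc n) (n ∸ b) (suc b ∸ (n ∸ b)) (size-∑ (λ _ → 1) (suc b)) (size-∑ down (suc b))
        (trans (m≤n⇒m⊔n≡n n∸b≤1+b) (sym (m+[n∸m]≡n n∸b≤1+b)))
        (trans (cong (_* (n C suc b)) (m≤n⇒m⊔n≡n n∸b≤1+b)) (suc*C n b))
        (inflow-suc b) (outflow≤ b) (upper-half b (s≤s⁻¹ m<1+b)) (flux (suc b))
      where
      -- For odd `n` and `b = ⌊ n /2⌋` this is an equality: the two middle levels have the same size
      -- and nobody stops between them.
      n∸b≤1+b : n ∸ b ≤ suc b
      n∸b≤1+b = ≤-trans (∸-monoʳ-≤ n (s≤s⁻¹ m<1+b)) (≤-trans (∸-monoˡ-≤ ⌊ n /2⌋ n≤1+2*⌊n/2⌋)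
        (≤-trans (≤-reflexive (m+n∸n≡m (suc ⌊ n /2⌋) ⌊ n /2⌋)) m<1+b))

    -- At level `n` only the full set remains: its mass, at most one, cancels against `n C n = 1`.
    comparabilities : suc n * length F ≤ suc n * midBinom n + 2 * ∑ F down
    comparabilities = *-cancelˡ-≤ (scale n) (+-cancelʳ-≤ (N * (scale n * 1)) _ _ (begin
      scale n * (N * length F) + N * (scale n * 1)
        ≡⟨ cong₂ (λ x y → x + N * (scale n * y)) (swap (scale n) N (length F)) (sym (nCn≡1 n)) ⟩
      N * (scale n * length F) + N * (scale n * (n C n))
        ≡⟨ cong (λ z → N * (scale n * z) + N * (scale n * (n C n)))
             (trans (length≡∑1 F) (sym (cumulative-by-size F _))) ⟩
      N * (scale n * sizes n) + N * (scale n * (n C n))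
        ≤⟨ upper-half n (⌊n/2⌋≤n n) ⟩
      N * (scale n * midBinom n) + N * outflow n + 2 * (scale n * downs n)
        ≤⟨ +-monoˡ-≤ (2 * (scale n * downs n)) (+-monoʳ-≤ (N * (scale n * midBinom n)) (*-monoʳ-≤ N
             (≤-trans (outflow≤ n) (≤-reflexive (trans (cong (_* scale n) (nCn≡1 n)) (*-comm 1 (scale n))))))) ⟩
      N * (scale n * midBinom n) + N * (scale n * 1) + 2 * (scale n * downs n)
        ≡⟨ cong (λ z → N * (scale n * midBinom n) + N * (scale n * 1) + 2 * (scale n * z)) (cumulative-by-size F down) ⟩
      N * (scale n * midBinom n) + N * (scale n * 1) + 2 * (scale n * ∑ F down)
        ≡⟨ gather N (scale n) (midBinom n) (∑ F down) ⟩
      scale n * (N * midBinom n + 2 * ∑ F down) + N * (scale n * 1) ∎))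
      where
      open ≤-Reasoning
      N = suc n
      instance
        scale≢0 : NonZero (scale n)
        scale≢0 = >-nonZero (scale>0 n)
      swap : ∀ s N l → s * (N * l) ≡ N * (s * l)
      swap = solve-∀
      gather : ∀ N s M d → N * (s * M) + N * (s * 1) + 2 * (s * d) ≡ s * (N * M + 2 * d) + N * (s * 1)
      gather = solve-∀

  -- Embedding trees in a graph

  data Side : Set where
    lower upper : Side

  opposite : Side → Side
  opposite lower = upper
  opposite upper = lower

  -- Tree j has 2 + j vertices; the vertex attached last is numbered zero.
  data Tree : ℕ → Set where
    edge : Tree 0
    grow : ∀ {j} → Tree j → Fin (2 + j) → Tree (suc j)

  side : ∀ {j} → Tree j → Fin (2 + j) → Side
  side edge       zero       = lower
  side edge       (suc zero) = upper
  side (grow T i) zero       = opposite (side T i)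
  side (grow T i) (suc v)    = side T v

  -- The side is that of the first vertex: a leaf attached to a lower vertex lies above it.
  Joined : {X : Set} → Rel X 0ℓ → Side → Rel X 0ℓ
  Joined E lower x y = E x y
  Joined E upper x y = E y x

  module Graph {X : Set} (_≟_ : DecidableEquality X) (V : List X) (V! : Unique V) where

    open DecVec _≟_ using (_∈?_)

    -- Freshness is demanded of the leaves only; the ends of the base edge differ once `E` is
    -- irreflexive.
    Embeds : ∀ {j} → Rel X 0ℓ → Tree j → Vec X (2 + j) → Set
    Embeds E edge       (x ∷ y ∷ []) = x ∈ V × y ∈ V × E x y
    Embeds E (grow T i) (x ∷ xs)     = x ∈ V × ¬ (x Vec.∈ xs) × Joined E (side T i) (lookup xs i) x × Embeds E T xs

    Embeds-mono : ∀ {j} {E E′ : Rel X 0ℓ} (T : Tree j) {xs} → (∀ {x y} → E x y → E′ x y) → Embeds E T xs → Embeds E′ T xs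
    Embeds-mono edge {x ∷ y ∷ []} E⇒E′ (x∈ , y∈ , e) = x∈ , y∈ , E⇒E′ e
    Embeds-mono (grow T i) {x ∷ xs} E⇒E′ (x∈ , x∉ , e , emb) with side T i
    ... | lower = x∈ , x∉ , E⇒E′ e , Embeds-mono T E⇒E′ emb
    ... | upper = x∈ , x∉ , E⇒E′ e , Embeds-mono T E⇒E′ emb

    -- Every tree vertex has an edge on its own side. In a pruned graph that edge certifies that the
    -- image has high degree there.
    Embeds-joined : ∀ {j} {E : Rel X 0ℓ} (T : Tree j) {xs} → Embeds E T xs → ∀ v → ∃[ y ] Joined E (side T v) (lookup xs v) y
    Embeds-joined edge {x ∷ y ∷ []} (_ , _ , e) zero       = y , e
    Embeds-joined edge {x ∷ y ∷ []} (_ , _ , e) (suc zero) = x , e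
    Embeds-joined (grow T i) {x ∷ xs} (_ , _ , e , emb) (suc v) = Embeds-joined T emb v
    Embeds-joined (grow T i) {x ∷ xs} (_ , _ , e , emb) zero with side T i
    ... | lower = lookup xs i , e
    ... | upper = lookup xs i , e

    Embeds-∈ : ∀ {j} {E : Rel X 0ℓ} (T : Tree j) {xs} → Embeds E T xs → ∀ v → lookup xs v ∈ V
    Embeds-∈ edge {x ∷ y ∷ []} (x∈ , _ , _)  zero       = x∈
    Embeds-∈ edge {x ∷ y ∷ []} (_ , y∈ , _)  (suc zero) = y∈
    Embeds-∈ (grow T i) {x ∷ xs} (x∈ , _)    zero       = x∈
    Embeds-∈ (grow T i) {x ∷ xs} (_ , _ , _ , emb) (suc v) = Embeds-∈ T emb v

    Embeds-injective : ∀ {j} {E : Rel X 0ℓ} (T : Tree j) {xs} → (∀ {x} → ¬ E x x) → Embeds E T xs → Injective _≡_ _≡_ (lookup xs)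
    Embeds-injective edge {x ∷ y ∷ []} irr (_ , _ , e) {zero}     {zero}     eq   = refl
    Embeds-injective edge {x ∷ y ∷ []} irr (_ , _ , e) {zero}     {suc zero} refl = contradiction e irr
    Embeds-injective edge {x ∷ y ∷ []} irr (_ , _ , e) {suc zero} {zero}     refl = contradiction e irr
    Embeds-injective edge {x ∷ y ∷ []} irr (_ , _ , e) {suc zero} {suc zero} eq   = refl
    Embeds-injective (grow T i) {x ∷ xs} irr (_ , x∉ , _ , emb) {zero}  {zero}  eq   = refl
    Embeds-injective (grow T i) {x ∷ xs} irr (_ , x∉ , _ , emb) {zero}  {suc v} refl = contradiction (∈-lookup v xs) x∉
    Embeds-injective (grow T i) {x ∷ xs} irr (_ , x∉ , _ , emb) {suc u} {zero}  refl = contradiction (∈-lookup u xs) x∉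
    Embeds-injective (grow T i) {x ∷ xs} irr (_ , x∉ , _ , emb) {suc u} {suc v} eq   = cong suc (Embeds-injective T irr emb eq)

    joined? : ∀ {E : Rel X 0ℓ} → Decidable E → ∀ s → Decidable (Joined E s)
    joined? E? lower x y = E? x y
    joined? E? upper x y = E? y x

    degree : ∀ {E : Rel X 0ℓ} → Decidable E → Side → X → ℕ
    degree E? s x = ∑ V (λ y → 𝟙 (joined? E? s x y))

    edges : ∀ {E : Rel X 0ℓ} → Decidable E → ℕ
    edges E? = ∑ V (degree E? lower)

    -- Pruning and the count of embeddings.

    module _ (τ : ℕ) where

      -- Degrees are measured in `E`, before anything is discarded, and may drop afterwards; hence a
      -- new pruning for each leaf. Both ends are tested because a leaf may be attached above or
      -- below.
      Prune : ∀ {E : Rel X 0ℓ} → Decidable E → Rel X 0ℓ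
      Prune {E} E? x y = E x y × τ ≤ degree E? lower x × τ ≤ degree E? upper y

      prune? : ∀ {E : Rel X 0ℓ} (E? : Decidable E) → Decidable (Prune E?)
      prune? E? x y = E? x y ×-dec τ ≤? degree E? lower x ×-dec τ ≤? degree E? upper y

      low? : ∀ {E : Rel X 0ℓ} (E? : Decidable E) s x y → Dec (Joined E s x y × degree E? s x < τ)
      low? E? s x y = joined? E? s x y ×-dec degree E? s x <? τ

      ∑-low≤τ : ∀ {E : Rel X 0ℓ} (E? : Decidable E) s x → ∑ V (λ y → 𝟙 (low? E? s x y)) ≤ τ
      ∑-low≤τ E? s x with <-≤-connex (degree E? s x) τ
      ... | inj₁ deg<τ = ≤-trans (∑-mono V λ y → 𝟙-mono proj₁ (low? E? s x y) (joined? E? s x y)) (<⇒≤ deg<τ)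
      ... | inj₂ τ≤deg = ≤-trans (∑-≤-const V λ {y} _ → ≤-reflexive (𝟙-no (low? E? s x y) (≤⇒≯ τ≤deg ∘ proj₂)))
                                 (≤-trans (≤-reflexive (*-zeroʳ (length V))) z≤n)

      -- A discarded pair has an end of degree below `τ`, and each vertex is to blame for at most
      -- `τ` pairs on each side.
      edges-prune : ∀ {E : Rel X 0ℓ} (E? : Decidable E) → edges E? ≤ edges (prune? E?) + 2 * (length V * τ)
      edges-prune E? = begin
        ∑ V (λ x → ∑ V (λ y → 𝟙 (E? x y)))
          ≤⟨ ∑-mono V (λ x → ∑-mono V (λ y → cases x y)) ⟩
        ∑ V (λ x → ∑ V (λ y → kept x y + (lowˡ x y + lowᵘ x y)))
          ≡⟨ ∑-cong-∈ V (λ {x} _ → trans (∑-distrib-+ V (kept x) _) (cong (∑ V (kept x) +_) (∑-distrib-+ V (lowˡ x) (lowᵘ x)))) ⟩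
        ∑ V (λ x → ∑ V (kept x) + (∑ V (lowˡ x) + ∑ V (lowᵘ x)))
          ≡⟨ trans (∑-distrib-+ V _ _) (cong (edges (prune? E?) +_) (∑-distrib-+ V (λ x → ∑ V (lowˡ x)) _)) ⟩
        edges (prune? E?) + (∑ V (λ x → ∑ V (lowˡ x)) + ∑ V (λ x → ∑ V (lowᵘ x)))
          ≡⟨ cong (λ z → edges (prune? E?) + (∑ V (λ x → ∑ V (lowˡ x)) + z)) (∑-comm V V lowᵘ) ⟩
        edges (prune? E?) + (∑ V (λ x → ∑ V (lowˡ x)) + ∑ V (λ y → ∑ V (λ x → lowᵘ x y)))
          ≤⟨ +-monoʳ-≤ (edges (prune? E?)) (+-mono-≤ (∑-≤-const V λ {x} _ → ∑-low≤τ E? lower x)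
                                                     (∑-≤-const V λ {y} _ → ∑-low≤τ E? upper y)) ⟩
        edges (prune? E?) + (length V * τ + length V * τ)
          ≡⟨ cong (λ z → edges (prune? E?) + (length V * τ + z)) (+-identityʳ (length V * τ)) ⟨
        edges (prune? E?) + 2 * (length V * τ) ∎
        where
        open ≤-Reasoning
        kept lowˡ lowᵘ : X → X → ℕ
        kept x y = 𝟙 (prune? E? x y)
        lowˡ x y = 𝟙 (low? E? lower x y)
        lowᵘ x y = 𝟙 (low? E? upper y x)
        cases : ∀ x y → 𝟙 (E? x y) ≤ kept x y + (lowˡ x y + lowᵘ x y)
        cases x y with ≤-<-connex τ (degree E? lower x) | ≤-<-connex τ (degree E? upper y)
        ... | inj₂ low | _        = ≤-trans (≤-trans (𝟙-mono (_, low) (E? x y) (low? E? lower x y)) (m≤m+n _ (lowᵘ x y))) (m≤n+m _ (kept x y))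
        ... | inj₁ _   | inj₂ low = ≤-trans (≤-trans (𝟙-mono (_, low) (E? x y) (low? E? upper y x)) (m≤n+m _ (lowˡ x y))) (m≤n+m _ (kept x y))
        ... | inj₁ p   | inj₁ q   = ≤-trans (𝟙-mono (_, p , q) (E? x y) (prune? E? x y)) (m≤m+n _ _)

      extension? : ∀ {j} {E : Rel X 0ℓ} (E? : Decidable E) (T : Tree j) i (xs : Vec X (2 + j)) x →
        Dec (Joined E (side T i) (lookup xs i) x × ¬ (x Vec.∈ xs))
      extension? E? T i xs x = joined? E? (side T i) (lookup xs i) x ×-dec ¬? (x ∈? xs)

      extensions : ∀ {j} {E : Rel X 0ℓ} (E? : Decidable E) → Tree j → Fin (2 + j) → Vec X (2 + j) → List X
      extensions E? T i xs = filter (extension? E? T i xs) V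

      -- The smaller tree is placed in the pruned graph and the last leaf is attached along an edge
      -- of `E`, so the base edge lies in the graph pruned `j` times.
      embeddings : ∀ {j} {E : Rel X 0ℓ} → Decidable E → Tree j → List (Vec X (2 + j))
      embeddings E? edge       = map (λ (x , y) → x ∷ y ∷ []) (filter (λ (x , y) → E? x y) (cartesianProduct V V))
      embeddings E? (grow T i) = concatMap (λ xs → map (_∷ xs) (extensions E? T i xs)) (embeddings (prune? E?) T)

      embeddings-sound : ∀ {j} {E : Rel X 0ℓ} (E? : Decidable E) (T : Tree j) {xs} → xs ∈ embeddings E? T → Embeds E T xs
      embeddings-sound E? edge xs∈ with ∈-map⁻ _ xs∈
      ... | (x , y) , xy∈ , refl with ∈-filter⁻ (λ (x , y) → E? x y) {xs = cartesianProduct V V} xy∈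
      ...   | xy∈V , e with ∈-cartesianProduct⁻ V V xy∈V
      ...     | x∈ , y∈ = x∈ , y∈ , e
      embeddings-sound E? (grow T i) xs∈ with find (∈-concatMap⁻ _ {xs = embeddings (prune? E?) T} xs∈)
      ... | ys , ys∈ , xs∈′ with ∈-map⁻ _ xs∈′
      ...   | x , x∈ , refl with ∈-filter⁻ (extension? E? T i ys) {xs = V} x∈
      ...     | x∈V , e , x∉ = x∈V , x∉ , e , Embeds-mono T proj₁ (embeddings-sound (prune? E?) T ys∈)

      concatMap-∷-unique : ∀ {k} (ext : Vec X k → List X) → (∀ xs → Unique (ext xs)) → ∀ {xss} → Unique xss →
        Unique (concatMap (λ xs → map (_∷ xs) (ext xs)) xss)
      concatMap-∷-unique ext ext! []         = []
      concatMap-∷-unique ext ext! {xs ∷ xss} (xs∉ ∷ xss!) =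
        Unique.++⁺ (Unique.map⁺ ∷-injectiveˡ (ext! xs)) (concatMap-∷-unique ext ext! xss!) disjoint
        where
        disjoint : ∀ {ys} → ¬ (ys ∈ map (_∷ xs) (ext xs) × ys ∈ concatMap (λ xs → map (_∷ xs) (ext xs)) xss)
        disjoint (ys∈₁ , ys∈₂) with ∈-map⁻ _ ys∈₁ | find (∈-concatMap⁻ _ {xs = xss} ys∈₂)
        ... | _ , _ , refl | zs , zs∈ , ys∈₃ with ∈-map⁻ _ ys∈₃
        ...   | _ , _ , eq = All.lookup xs∉ zs∈ (∷-injectiveʳ eq)

      embeddings-unique : ∀ {j} {E : Rel X 0ℓ} (E? : Decidable E) (T : Tree j) → Unique (embeddings E? T)
      embeddings-unique E? edge       = Unique.map⁺ (λ { refl → refl }) (Unique.filter⁺ _ (Unique.cartesianProduct⁺ V! V!))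
      embeddings-unique E? (grow T i) = concatMap-∷-unique _ (λ xs → Unique.filter⁺ _ V!) (embeddings-unique (prune? E?) T)

      Prune-degree : ∀ {E : Rel X 0ℓ} (E? : Decidable E) s {x y} → Joined (Prune E?) s x y → τ ≤ degree E? s x
      Prune-degree E? lower (_ , τ≤ , _) = τ≤
      Prune-degree E? upper (_ , _ , τ≤) = τ≤

      -- The image of the parent has at least `τ` neighbours in `E` on the required side, of which
      -- at most `2 + j` are already used.
      extensions-many : ∀ {j} {E : Rel X 0ℓ} (E? : Decidable E) (T : Tree j) i {xs s} → s + (2 + j) ≤ τ →
        Embeds (Prune E?) T xs → s ≤ length (extensions E? T i xs)
      extensions-many {j} E? T i {xs} {s} s≤ emb = +-cancelʳ-≤ (2 + j) _ _ (begin
        s + (2 + j)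
          ≤⟨ s≤ ⟩
        τ
          ≤⟨ Prune-degree E? (side T i) (proj₂ (Embeds-joined T emb i)) ⟩
        degree E? (side T i) (lookup xs i)
          ≤⟨ ∑-mono V split ⟩
        ∑ V (λ x → 𝟙 (extension? E? T i xs x) + 𝟙 (x ∈? xs))
          ≡⟨ ∑-distrib-+ V _ _ ⟩
        ∑ V (λ x → 𝟙 (extension? E? T i xs x)) + ∑ V (λ x → 𝟙 (x ∈? xs))
          ≡⟨ cong₂ _+_ (length-filter≡∑ (extension? E? T i xs) V) (length-filter≡∑ (_∈? xs) V) ⟨
        length (extensions E? T i xs) + length (filter (_∈? xs) V)
          ≤⟨ +-monoʳ-≤ _ (length-unique-⊆ (Unique.filter⁺ _ V!) λ x∈ → ∈-toList⁺ (proj₂ (∈-filter⁻ (_∈? xs) {xs = V} x∈))) ⟩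
        length (extensions E? T i xs) + length (toList xs)
          ≡⟨ cong (length (extensions E? T i xs) +_) (length-toList xs) ⟩
        length (extensions E? T i xs) + (2 + j) ∎)
        where
        open ≤-Reasoning
        split : ∀ x → 𝟙 (joined? E? (side T i) (lookup xs i) x) ≤ 𝟙 (extension? E? T i xs x) + 𝟙 (x ∈? xs)
        split x with x ∈? xs
        ... | yes x∈ = ≤-trans (𝟙-mono (λ _ → x∈) (joined? E? (side T i) (lookup xs i) x) (yes x∈)) (m≤n+m 1 _)
        ... | no x∉  = ≤-trans (𝟙-mono (_, x∉) (joined? E? (side T i) (lookup xs i) x) (joined? E? (side T i) (lookup xs i) x ×-dec yes x∉)) (m≤m+n _ 0)

      length-concatMap-≥ : ∀ {k s} (f : Vec X k → List (Vec X (suc k))) xss → (∀ {xs} → xs ∈ xss → s ≤ length (f xs)) →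
        length xss * s ≤ length (concatMap f xss)
      length-concatMap-≥ f []         h = z≤n
      length-concatMap-≥ f (xs ∷ xss) h = ≤-trans (+-mono-≤ (h (here refl)) (length-concatMap-≥ f xss (h ∘ there)))
        (≤-reflexive (sym (length-++ (f xs))))

      -- Each leaf costs one pruning and gains a factor `s`; for a single edge the count is exact.
      embeddings-many : ∀ {j} {E : Rel X 0ℓ} {s} (E? : Decidable E) (T : Tree j) → s + (2 + j) ≤ τ →
        (edges E? ∸ j * (2 * (length V * τ))) * s ^ j ≤ length (embeddings E? T)
      embeddings-many E? edge s≤ = ≤-reflexive (begin
        edges E? * 1                                                   ≡⟨ *-identityʳ (edges E?) ⟩
        edges E?                                                       ≡⟨ pairs V ⟨
        ∑ (cartesianProduct V V) (λ (x , y) → 𝟙 (E? x y))              ≡⟨ length-filter≡∑ _ (cartesianProduct V V) ⟨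
        length (filter (λ (x , y) → E? x y) (cartesianProduct V V))    ≡⟨ length-map _ (filter _ (cartesianProduct V V)) ⟨
        length (embeddings E? edge)                                    ∎)
        where
        open ≡-Reasoning
        pairs : ∀ xs → ∑ (cartesianProduct xs V) (λ (x , y) → 𝟙 (E? x y)) ≡ ∑ xs (degree E? lower)
        pairs []       = refl
        pairs (x ∷ xs) = trans (∑-++ (map (x ,_) V) _ _) (cong₂ _+_ (∑-map V (x ,_) _) (pairs xs))
      embeddings-many {suc j} {_} {s} E? (grow T i) s≤ = begin
        (edges E? ∸ (c + j * c)) * (s * s ^ j)
          ≡⟨ cong (_* (s * s ^ j)) (∸-+-assoc (edges E?) c (j * c)) ⟨
        (edges E? ∸ c ∸ j * c) * (s * s ^ j)
          ≤⟨ *-monoˡ-≤ (s * s ^ j) (∸-monoˡ-≤ (j * c) (m≤n+o⇒m∸n≤o (edges E?) c (≤-trans (edges-prune E?) (≤-reflexive (+-comm _ c))))) ⟩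
        (edges (prune? E?) ∸ j * c) * (s * s ^ j)
          ≡⟨ reorder (edges (prune? E?) ∸ j * c) s (s ^ j) ⟩
        (edges (prune? E?) ∸ j * c) * s ^ j * s
          ≤⟨ *-monoˡ-≤ s (embeddings-many (prune? E?) T s≤′) ⟩
        length (embeddings (prune? E?) T) * s
          ≤⟨ length-concatMap-≥ _ _ (λ {xs} xs∈ → ≤-trans (extensions-many E? T i s≤′ (embeddings-sound (prune? E?) T xs∈))
               (≤-reflexive (sym (length-map (_∷ xs) (extensions E? T i xs))))) ⟩
        length (embeddings E? (grow T i)) ∎
        where
        open ≤-Reasoning
        c = 2 * (length V * τ)
        s≤′ : s + (2 + j) ≤ τ
        s≤′ = ≤-trans (+-monoʳ-≤ s (n≤1+n (2 + j))) s≤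
        reorder : ∀ x s p → x * (s * p) ≡ x * p * s
        reorder = solve-∀

  -- Tree posets of height two

  data Arc : ∀ {j} → Tree j → Fin (2 + j) → Fin (2 + j) → Set where
    base : Arc edge zero (suc zero)
    old  : ∀ {j} {T : Tree j} {i u v} → Arc T u v → Arc (grow T i) (suc u) (suc v)
    up   : ∀ {j} {T : Tree j} {i} → side T i ≡ lower → Arc (grow T i) (suc i) zero
    down : ∀ {j} {T : Tree j} {i} → side T i ≡ upper → Arc (grow T i) zero (suc i)

  module HeightTwoTree {m : ℕ} (_≼_ : Rel (Fin m) 0ℓ) (po : IsPartialOrder _≡_ _≼_)
    (connected : FinPoset.Connected _≼_) (acyclic : ¬ FinPoset.HasCycle _≼_) (height : FinPoset.HasHeight _≼_ 2) where

    open FinPoset _≼_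
    open IsPartialOrder po using (antisym) renaming (trans to ≼-trans)
    open DecVec (Fin._≟_ {m}) using (_∈?_)

    ≺-asym : ∀ {p q} → p ≺ q → ¬ (q ≺ p)
    ≺-asym (p≼q , p≢q) (q≼p , _) = p≢q (antisym p≼q q≼p)

    no-3-chain : ∀ {p q r} → p ≺ q → ¬ (q ≺ r)
    no-3-chain {p} {q} {r} p≺q@(p≼q , p≢q) q≺r@(q≼r , q≢r) =
      1+n≰n (proj₂ height (p ∷ q ∷ r ∷ [])
        ( ((p≢q ∷ p≢r ∷ []) ∷ (q≢r ∷ []) ∷ [] ∷ [])
        , ((inj₁ p≼q ∷ inj₁ (≼-trans p≼q q≼r) ∷ []) ∷ (inj₁ q≼r ∷ []) ∷ [] ∷ []) ))
      where
      p≢r : p ≢ r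
      p≢r refl = ≺-asym p≺q q≺r

    -- Height two leaves no room for an intermediate element, so every strict relation is an arc of
    -- the Hasse diagram.
    ≺⇒Adj : ∀ {p q} → p ≺ q → Adj p q
    ≺⇒Adj p≺q = inj₁ (p≺q , λ (_ , p≺z , z≺q) → no-3-chain p≺z z≺q)

    Adj-sym : ∀ {p q} → Adj p q → Adj q p
    Adj-sym = Sum.swap

    data Path : Fin m → List (Fin m) → Fin m → Set where
      end  : ∀ {p} → Path p (p ∷ []) p
      cons : ∀ {p q r ps} → Adj p q → p ∉ ps → Path q ps r → Path p (p ∷ ps) r

    snoc : ∀ {p q r ps} → Path p ps q → Adj q r → r ∉ ps → Path p (ps ++ r ∷ []) r
    snoc end q~r r∉ = cons q~r (λ { (here refl) → r∉ (here refl) }) end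
    snoc {p} {q} {r} (cons {ps = ps} p~ p∉ path) q~r r∉ = cons p~ p∉′ (snoc path q~r (r∉ ∘ there))
      where
      p∉′ : p ∉ ps ++ r ∷ []
      p∉′ p∈ with ∈-++⁻ ps p∈
      ... | inj₁ p∈ps        = p∉ p∈ps
      ... | inj₂ (here refl) = r∉ (here refl)

    Path-unique : ∀ {p q ps} → Path p ps q → Unique ps
    Path-unique end             = [] ∷ []
    Path-unique (cons _ p∉ path) = All.tabulate (λ { q∈ refl → p∉ q∈ }) ∷ Path-unique path

    Path-linked : ∀ {x p q r ps} → Adj x p → Path p ps q → Adj q r → Linked Adj (x ∷ ps ++ r ∷ [])
    Path-linked x~p end q~r              = x~p ∷ q~r ∷ [-]
    Path-linked x~p (cons p~ _ path) q~r = x~p ∷ Path-linked p~ path q~r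

    Path-long : ∀ {p q ps} → Path p ps q → p ≢ q → 2 ≤ length ps
    Path-long end p≢q                         = contradiction refl p≢q
    Path-long (cons _ _ end) p≢q              = s≤s (s≤s z≤n)
    Path-long (cons _ _ (cons _ _ _)) p≢q     = s≤s (s≤s z≤n)

    -- With distinct ends the path has at least two vertices, and `x` closes it to a cycle.
    one-neighbour : ∀ {x p q ps} → Path p ps q → x ∉ ps → Adj x p → Adj q x → p ≡ q
    one-neighbour {x} {p} {q} {ps} path x∉ x~p q~x = decidable-stable (p Fin.≟ q) λ p≢q →
      acyclic (x , ps , Path-long path p≢q , All.tabulate (λ { y∈ refl → x∉ y∈ }) ∷ Path-unique path , Path-linked x~p path q~x)

    Neighboured : Side → Fin m → Set
    Neighboured lower p = ∃[ q ] p ≺ q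
    Neighboured upper p = ∃[ q ] q ≺ p

    -- The invariant of a vertex-by-vertex exploration. `arcs` goes only from the order to the tree,
    -- which is all that monotone copies require; `sides` and height two fix the orientation of a
    -- new leaf; `paths` and acyclicity make its parent unique.
    record Spans {j} (T : Tree j) (vs : Vec (Fin m) (2 + j)) : Set where
      field
        distinct : Injective _≡_ _≡_ (lookup vs)
        arcs     : ∀ {u v} → lookup vs u ≺ lookup vs v → Arc T u v
        sides    : ∀ u → Neighboured (side T u) (lookup vs u)
        paths    : ∀ u v → ∃[ ps ] (Path (lookup vs u) ps (lookup vs v) × (∀ {p} → p ∈ ps → p Vec.∈ vs))

    open Spans

    spans-edge : ∀ {p q} → p ≺ q → Spans edge (p ∷ q ∷ [])
    spans-edge {p} {q} p≺q = record { distinct = dist _ _ ; arcs = arc _ _ ; sides = sid ; paths = pth }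
      where
      vs = p ∷ q ∷ []
      dist : ∀ u v → lookup vs u ≡ lookup vs v → u ≡ v
      dist zero       zero       eq = refl
      dist zero       (suc zero) eq = contradiction eq (proj₂ p≺q)
      dist (suc zero) zero       eq = contradiction (sym eq) (proj₂ p≺q)
      dist (suc zero) (suc zero) eq = refl
      arc : ∀ u v → lookup vs u ≺ lookup vs v → Arc edge u v
      arc zero       zero       (_ , neq) = contradiction refl neq
      arc zero       (suc zero) _         = base
      arc (suc zero) zero       q≺p       = contradiction q≺p (≺-asym p≺q)
      arc (suc zero) (suc zero) (_ , neq) = contradiction refl neq
      sid : ∀ u → Neighboured (side edge u) (lookup vs u)
      sid zero       = q , p≺q
      sid (suc zero) = p , p≺q
      pth : ∀ u v → ∃[ ps ] (Path (lookup vs u) ps (lookup vs v) × (∀ {r} → r ∈ ps → r Vec.∈ vs))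
      pth zero       zero       = _ , end , λ { (here refl) → ∈-lookup zero vs }
      pth (suc zero) (suc zero) = _ , end , λ { (here refl) → ∈-lookup (suc zero) vs }
      pth zero       (suc zero) = _ , cons (≺⇒Adj p≺q) (λ { (here refl) → proj₂ p≺q refl }) end ,
        λ { (here refl) → ∈-lookup zero vs ; (there (here refl)) → ∈-lookup (suc zero) vs }
      pth (suc zero) zero       = _ , cons (Adj-sym (≺⇒Adj p≺q)) (λ { (here refl) → proj₂ p≺q refl }) end ,
        λ { (here refl) → ∈-lookup (suc zero) vs ; (there (here refl)) → ∈-lookup zero vs }

    spans-grow : ∀ {j} {T : Tree j} {vs} → Spans T vs → ∀ i {x} → ¬ (x Vec.∈ vs) → Adj (lookup vs i) x →
      Spans (grow T i) (x ∷ vs)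
    spans-grow {j} {T} {vs} S i {x} x∉ i~x = record { distinct = dist _ _ ; arcs = arc _ _ ; sides = sid ; paths = pth }
      where
      dist : ∀ u v → lookup (x ∷ vs) u ≡ lookup (x ∷ vs) v → u ≡ v
      dist zero    zero    eq   = refl
      dist zero    (suc v) refl = contradiction (∈-lookup v vs) x∉
      dist (suc u) zero    refl = contradiction (∈-lookup u vs) x∉
      dist (suc u) (suc v) eq   = cong suc (distinct S eq)

      parent : ∀ v → Adj (lookup vs v) x → v ≡ i
      parent v v~x with paths S v i
      ... | ps , path , ps⊆vs = distinct S (one-neighbour path (x∉ ∘ ps⊆vs) (Adj-sym v~x) i~x)

      -- A vertex on the upper side already has an element beneath it, so `x` above it would
      -- complete a 3-chain.
      below : ∀ v → lookup vs v ≺ x → side T v ≡ lower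
      below v v≺x with side T v | sides S v
      ... | lower | _       = refl
      ... | upper | q , q≺v = contradiction v≺x (no-3-chain q≺v)

      above : ∀ v → x ≺ lookup vs v → side T v ≡ upper
      above v x≺v with side T v | sides S v
      ... | lower | q , v≺q = contradiction v≺q (no-3-chain x≺v)
      ... | upper | _       = refl

      arc : ∀ u v → lookup (x ∷ vs) u ≺ lookup (x ∷ vs) v → Arc (grow T i) u v
      arc zero    zero    (_ , neq) = contradiction refl neq
      arc (suc u) (suc v) u≺v       = old (arcs S u≺v)
      arc zero    (suc v) x≺v with refl ← parent v (Adj-sym (≺⇒Adj x≺v)) = down (above v x≺v)
      arc (suc u) zero    u≺x with refl ← parent u (≺⇒Adj u≺x)           = up (below u u≺x)

      sid : ∀ u → Neighboured (side (grow T i) u) (lookup (x ∷ vs) u)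
      sid (suc u) = sides S u
      sid zero    = joined i~x
        where
        joined : Adj (lookup vs i) x → Neighboured (opposite (side T i)) x
        joined (inj₁ (i≺x , _)) rewrite below i i≺x = lookup vs i , i≺x
        joined (inj₂ (x≺i , _)) rewrite above i x≺i = lookup vs i , x≺i

      pth : ∀ u v → ∃[ ps ] (Path (lookup (x ∷ vs) u) ps (lookup (x ∷ vs) v) × (∀ {p} → p ∈ ps → p Vec.∈ (x ∷ vs)))
      pth zero    zero    = _ , end , λ { (here refl) → VecAny.here refl }
      pth (suc u) (suc v) with paths S u v
      ... | ps , path , ps⊆vs = ps , path , VecAny.there ∘ ps⊆vs
      pth zero    (suc v) with paths S i v
      ... | ps , path , ps⊆vs = _ , cons (Adj-sym i~x) (x∉ ∘ ps⊆vs) path ,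
        λ { (here refl) → VecAny.here refl ; (there p∈) → VecAny.there (ps⊆vs p∈) }
      pth (suc u) zero    with paths S u i
      ... | ps , path , ps⊆vs = _ , snoc path i~x (x∉ ∘ ps⊆vs) , sub
        where
        sub : ∀ {p} → p ∈ ps ++ x ∷ [] → p Vec.∈ (x ∷ vs)
        sub p∈ with ∈-++⁻ ps p∈
        ... | inj₁ p∈ps        = VecAny.there (ps⊆vs p∈ps)
        ... | inj₂ (here refl) = VecAny.here refl

    exit : ∀ {k} (vs : Vec (Fin m) k) {p q} → Walk p q → p Vec.∈ vs → ¬ (q Vec.∈ vs) →
      ∃[ i ] ∃[ x ] (¬ (x Vec.∈ vs) × Adj (lookup vs i) x)
    exit vs here p∈ q∉ = contradiction p∈ q∉
    exit vs (step {q = r} p~r walk) p∈ q∉ with r ∈? vs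
    ... | yes r∈ = exit vs walk r∈ q∉
    ... | no r∉  = VecAny.index p∈ , r , r∉ , subst (λ z → Adj z r) (lookup-index p∈) p~r

    Spanning : Set
    Spanning = ∃[ j ] Σ (Tree j) λ T → ∃[ vs ] (Spans T vs × (∀ p → p Vec.∈ vs))

    -- The fuel `k` bounds the number of vertices still missing. Once it is used up, another vertex
    -- would inject `3 + j` indices into `Fin m`, although `m ≤ 2 + j`.
    complete : ∀ k {j} {T : Tree j} {vs} → m ≤ k + (2 + j) → Spans T vs → Spanning
    complete k {j} {T} {vs} m≤ S with any? (λ p → ¬? (p ∈? vs))
    ... | no ¬∉ = j , T , vs , S , λ p → decidable-stable (p ∈? vs) (λ p∉ → ¬∉ (p , p∉))
    complete zero {j} {T} {vs} m≤ S | yes (p , p∉) with exit vs (connected (lookup vs zero) p) (∈-lookup zero vs) p∉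
    ... | i , x , x∉ , i~x = contradiction (≤-trans (injective⇒≤ (distinct (spans-grow S i x∉ i~x))) m≤) 1+n≰n
    complete (suc k) {j} {T} {vs} m≤ S | yes (p , p∉) with exit vs (connected (lookup vs zero) p) (∈-lookup zero vs) p∉
    ... | i , x , x∉ , i~x = complete k (≤-trans m≤ (≤-reflexive (sym (+-suc k (2 + j))))) (spans-grow S i x∉ i~x)

    two-chain : ∃[ p ] ∃[ q ] p ≺ q
    two-chain with proj₁ height
    ... | p ∷ q ∷ [] , ((p≢q ∷ []) ∷ _ , (inj₁ p≼q ∷ []) ∷ _) , refl = p , q , p≼q , p≢q
    ... | p ∷ q ∷ [] , ((p≢q ∷ []) ∷ _ , (inj₂ q≼p ∷ []) ∷ _) , refl = q , p , q≼p , p≢q ∘ sym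

    spanning : Spanning
    spanning = complete m (m≤m+n m 2) (spans-edge (proj₂ (proj₂ two-chain)))

  -- Images of embeddings

  module Images {X : Set} (_≟_ : DecidableEquality X) {k : ℕ} where

    open DecVec _≟_ using (_∈?_)

    _⊑_ : Rel (Vec X k) 0ℓ
    xs ⊑ ys = ∀ v → lookup xs v Vec.∈ ys

    _⊑?_ : Decidable _⊑_
    xs ⊑? ys = all? λ v → lookup xs v ∈? ys

    -- Inclusion of images, rather than equality, is enough: at most k ^ k vectors lie below a given one.
    words : ∀ j → List X → List (Vec X j)
    words zero    l = [] ∷ []
    words (suc j) l = cartesianProductWith _∷_ l (words j l)

    length-words : ∀ j l → length (words j l) ≡ length l ^ j
    length-words zero    l = refl
    length-words (suc j) l = trans (size l) (cong (length l *_) (length-words j l))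
      where
      size : ∀ l′ → length (cartesianProductWith Vec._∷_ l′ (words j l)) ≡ length l′ * length (words j l)
      size []       = refl
      size (x ∷ l′) = trans (length-++ (map (x ∷_) (words j l))) (cong₂ _+_ (length-map (x ∷_) (words j l)) (size l′))

    ∈-words : ∀ {j l} (xs : Vec X j) → (∀ v → lookup xs v ∈ l) → xs ∈ words j l
    ∈-words []       h = here refl
    ∈-words (x ∷ xs) h = ∈-cartesianProductWith⁺ _∷_ (h zero) (∈-words xs (h ∘ suc))

    -- A greedy choice from the right. An entry is compared only with kept entries after it, which
    -- is the direction that `AllPairs` asks for.
    representatives : List (Vec X k) → List (Vec X k)
    representatives []        = []
    representatives (xs ∷ xss) with Any.any? (xs ⊑?_) (representatives xss)
    ... | yes _ = representatives xss
    ... | no _  = xs ∷ representatives xss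

    representatives-All : ∀ {P : Vec X k → Set} xss → All P xss → All P (representatives xss)
    representatives-All []         []         = []
    representatives-All (xs ∷ xss) (p ∷ ps) with Any.any? (xs ⊑?_) (representatives xss)
    ... | yes _ = representatives-All xss ps
    ... | no _  = p ∷ representatives-All xss ps

    representatives-⋢ : ∀ xss → AllPairs (λ xs ys → ¬ (xs ⊑ ys)) (representatives xss)
    representatives-⋢ []         = []
    representatives-⋢ (xs ∷ xss) with Any.any? (xs ⊑?_) (representatives xss)
    ... | yes _ = representatives-⋢ xss
    ... | no ¬r = ¬Any⇒All¬ _ ¬r ∷ representatives-⋢ xss

    representative : ∀ xss {xs} → xs ∈ xss → Any (xs ⊑_) (representatives xss)
    representative (xs ∷ xss) xs∈ with Any.any? (xs ⊑?_) (representatives xss) | xs∈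
    ... | yes r | here refl = r
    ... | no _  | here refl = here (λ v → ∈-lookup v xs)
    ... | yes _ | there xs∈′ = representative xss xs∈′
    ... | no _  | there xs∈′ = there (representative xss xs∈′)

    length-representatives : ∀ {xss} → Unique xss → length xss ≤ length (representatives xss) * k ^ k
    length-representatives {xss} xss! = begin
      length xss
        ≤⟨ length-unique-⊆ xss! (λ xs∈ → ∈-concatMap⁺ _ (Any.map (λ xs⊑ → ∈-words _ (∈-toList⁺ ∘ xs⊑)) (representative xss xs∈))) ⟩
      length (concatMap (words k ∘ toList) reps)
        ≡⟨ size reps ⟩
      length reps * k ^ k ∎
      where
      open ≤-Reasoning
      reps = representatives xss
      size : ∀ yss → length (concatMap (words k ∘ toList) yss) ≡ length yss * k ^ k
      size []         = refl
      size (ys ∷ yss) = trans (length-++ (words k (toList ys)))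
        (cong₂ _+_ (trans (length-words k (toList ys)) (cong (_^ k) (length-toList ys))) (size yss))

  -- From embeddings of the tree to copies of the poset.

  module _ {m n : ℕ} (_≼_ : Rel (Fin m) 0ℓ) (po : IsPartialOrder _≡_ _≼_)
    (connected : FinPoset.Connected _≼_) (acyclic : ¬ FinPoset.HasCycle _≼_) (height : FinPoset.HasHeight _≼_ 2)
    (F : List (Subset n)) (F! : Unique F) where

    open HeightTwoTree _≼_ po connected acyclic height
    open Graph (_≟ˢ_ {n}) F F!
    open Images (_≟ˢ_ {n})

    Embeds-arc : ∀ {j} {E : Rel (Subset n) 0ℓ} {T : Tree j} {xs u v} → Embeds E T xs → Arc T u v → E (lookup xs u) (lookup xs v)
    Embeds-arc {xs = x ∷ y ∷ []} (_ , _ , e)       base    = e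
    Embeds-arc {xs = x ∷ xs} (_ , _ , _ , emb)     (old a) = Embeds-arc emb a
    Embeds-arc {xs = x ∷ xs} (_ , _ , e , _)       (up {T = T} {i} eq) rewrite eq = e
    Embeds-arc {xs = x ∷ xs} (_ , _ , e , _)       (down {T = T} {i} eq) rewrite eq = e

    module _ {j} {T : Tree j} {vs} (S : Spans T vs) (full : ∀ p → p Vec.∈ vs) where

      position : Fin m → Fin (2 + j)
      position p = VecAny.index (full p)

      lookup-position : ∀ p → lookup vs (position p) ≡ p
      lookup-position p = sym (lookup-index (full p))

      position-lookup : ∀ v → position (lookup vs v) ≡ v
      position-lookup v = Spans.distinct S (lookup-position (lookup vs v))

      position-injective : Injective _≡_ _≡_ position
      position-injective {p} {q} eq = trans (sym (lookup-position p)) (trans (cong (lookup vs) eq) (lookup-position q))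

      m≡2+j : m ≡ 2 + j
      m≡2+j = ≤-antisym (injective⇒≤ position-injective) (injective⇒≤ (Spans.distinct S))

      copy : ∀ {xs} → Embeds _⊂_ T xs → Copy _≼_ F
      copy {xs} emb = record
        { emb       = λ p → lookup xs (position p)
        ; injective = position-injective ∘ Embeds-injective T (⊂-irref refl) emb
        ; monotone  = mono
        ; inF       = λ p → Embeds-∈ T emb (position p)
        }
        where
        mono : ∀ {p q} → p ≼ q → lookup xs (position p) ⊆ lookup xs (position q)
        mono {p} {q} p≼q with p Fin.≟ q
        ... | yes refl = ⊆-refl
        ... | no p≢q   = proj₁ (Embeds-arc emb (Spans.arcs S
                           (subst₂ (FinPoset._≺_ _≼_) (sym (lookup-position p)) (sym (lookup-position q)) (p≼q , p≢q))))

      copy-⊑ : ∀ {xs ys} (e : Embeds _⊂_ T xs) (f : Embeds _⊂_ T ys) → SameSubfamily (copy e) (copy f) → xs ⊑ ys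
      copy-⊑ {xs} {ys} e f same v with Equivalence.to (same (lookup xs v)) (lookup vs v , cong (lookup xs) (position-lookup v))
      ... | p , eq = subst (Vec._∈ ys) eq (∈-lookup (position p) ys)

      copies : ∀ {xss} → All (Embeds _⊂_ T) xss → List (Copy _≼_ F)
      copies = All.reduce copy

      copies-distinct : ∀ {xss} (es : All (Embeds _⊂_ T) xss) → AllPairs (λ xs ys → ¬ (xs ⊑ ys)) xss →
        AllPairs (λ c d → ¬ SameSubfamily c d) (copies es)
      copies-distinct []       []         = []
      copies-distinct {xs ∷ _} (e ∷ es) (⋢s ∷ ⋢ss) = first es ⋢s ∷ copies-distinct es ⋢ss
        where
        first : ∀ {yss} (fs : All (Embeds _⊂_ T) yss) → All (λ ys → ¬ (xs ⊑ ys)) yss → All (λ d → ¬ SameSubfamily (copy e) d) (copies fs)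
        first []       []       = []
        first (f ∷ fs) (⋢ ∷ ⋢s) = ⋢ ∘ copy-⊑ e f ∷ first fs ⋢s

      length-copies : ∀ {xss} (es : All (Embeds _⊂_ T) xss) → length (copies es) ≡ length xss
      length-copies []       = refl
      length-copies (e ∷ es) = cong suc (length-copies es)

      -- The factor `(2 + j) ^ (2 + j)` pays for passing from labelled embeddings to distinct
      -- subfamilies.
      many-copies : ∀ τ s → s + (2 + j) ≤ τ →
        Σ (List (Copy _≼_ F)) λ cs → AllPairs (λ c d → ¬ SameSubfamily c d) cs ×
          (edges _⊂?_ ∸ j * (2 * (length F * τ))) * s ^ j ≤ length cs * (2 + j) ^ (2 + j)
      many-copies τ s s≤ = copies embs , copies-distinct embs (representatives-⋢ xss) , (begin
        (edges _⊂?_ ∸ j * (2 * (length F * τ))) * s ^ j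
          ≤⟨ embeddings-many τ _⊂?_ T s≤ ⟩
        length xss
          ≤⟨ length-representatives (embeddings-unique τ _⊂?_ T) ⟩
        length (representatives xss) * (2 + j) ^ (2 + j)
          ≡⟨ cong (_* (2 + j) ^ (2 + j)) (length-copies embs) ⟨
        length (copies embs) * (2 + j) ^ (2 + j) ∎)
        where
        open ≤-Reasoning
        xss = embeddings τ _⊂?_ T
        embs = representatives-All xss (All.tabulate (embeddings-sound τ _⊂?_ T))

  -- Choice of the constants.

  ^-distribʳ-* : ∀ j a b → (a * b) ^ j ≡ a ^ j * b ^ j
  ^-distribʳ-* zero    a b = refl
  ^-distribʳ-* (suc j) a b = trans (cong (a * b *_) (^-distribʳ-* j a b)) (lemma a b (a ^ j) (b ^ j))
    where
    lemma : ∀ a b x y → a * b * (x * y) ≡ a * x * (b * y)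
    lemma = solve-∀

  -- L and e are the numbers of members and of comparable pairs of a family, N = n + 1 and M is the middle binomial.
  comparabilities-proportional : ∀ {r M L N e} → suc r * M ≤ r * L → N * L ≤ N * M + 2 * e → N * L ≤ 2 * suc r * e
  comparabilities-proportional {r} {M} {L} {N} {e} dense N*L≤ = +-cancelʳ-≤ (N * (r * L)) _ _ (begin
    N * L + N * (r * L)             ≡⟨ lhs r N L ⟩
    suc r * (N * L)                 ≤⟨ *-monoʳ-≤ (suc r) N*L≤ ⟩
    suc r * (N * M + 2 * e)         ≡⟨ rhs r N M e ⟩
    N * (suc r * M) + 2 * suc r * e ≤⟨ +-monoˡ-≤ (2 * suc r * e) (*-monoʳ-≤ N dense) ⟩
    N * (r * L) + 2 * suc r * e     ≡⟨ +-comm (N * (r * L)) _ ⟩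
    2 * suc r * e + N * (r * L)     ∎)
    where
    open ≤-Reasoning
    lhs : ∀ r N L → N * L + N * (r * L) ≡ (1 + r) * (N * L)
    lhs = solve-∀
    rhs : ∀ r N M e → (1 + r) * (N * M + 2 * e) ≡ N * ((1 + r) * M) + 2 * (1 + r) * e
    rhs = solve-∀

  module Constants (r j : ℕ) where

    -- With τ = (n + 1) / q the j prunings discard at most half of the comparable pairs, and n₀ ensures that
    -- s = τ - (2 + j) is at least n / (2 q).
    q : ℕ
    q = 8 * suc r * suc j

    n₀ : ℕ
    n₀ = 2 * q * (3 + j)

    -- The losses in `count`: `2 * suc r` from the number of pairs, 2 from pruning, `(2 * q) ^ j`
    -- from the bound on `s`, and the last power from embeddings with the same image.
    D : ℕ
    D = 4 * suc r * (2 * q) ^ j * (2 + j) ^ (2 + j)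

    instance
      D≢0 : NonZero D
      D≢0 = m*n≢0 (4 * suc r * (2 * q) ^ j) ((2 + j) ^ (2 + j))
        {{m*n≢0 (4 * suc r) ((2 * q) ^ j) {{_}} {{m^n≢0 (2 * q) j}}}} {{m^n≢0 (2 + j) (2 + j)}}

    module _ {n} (n≥n₀ : n₀ ≤ n) where

      τ s : ℕ
      τ = suc n / q
      s = τ ∸ (2 + j)

      q*τ≤ : q * τ ≤ suc n
      q*τ≤ = ≤-trans (≤-reflexive (*-comm q τ)) (m/n*n≤m (suc n) q)

      n<q*1+τ : suc n < q * suc τ
      n<q*1+τ = begin-strict
        suc n                  ≡⟨ m≡m%n+[m/n]*n (suc n) q ⟩
        suc n % q + τ * q      <⟨ +-monoˡ-< (τ * q) (m%n<n (suc n) q) ⟩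
        q + τ * q              ≡⟨ *-comm (suc τ) q ⟩
        q * suc τ              ∎
        where open ≤-Reasoning

      2+j≤τ : 2 + j ≤ τ
      2+j≤τ = s≤s⁻¹ (*-cancelˡ-≤ q (begin
        q * (3 + j)        ≤⟨ *-monoˡ-≤ (3 + j) (m≤m+n q (q + 0)) ⟩
        2 * q * (3 + j)    ≤⟨ n≥n₀ ⟩
        n                  ≤⟨ n≤1+n n ⟩
        suc n              ≤⟨ <⇒≤ n<q*1+τ ⟩
        q * suc τ          ∎))
        where open ≤-Reasoning

      s+2+j : s + (2 + j) ≡ τ
      s+2+j = m∸n+n≡m 2+j≤τ

      -- Rounding in `τ` costs 1 and the used vertices cost `2 + j`; `n₀` makes `q * (3 + j)` at
      -- most half of `n`.
      n≤2*q*s : n ≤ 2 * q * s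
      n≤2*q*s = +-cancelʳ-≤ n _ _ (begin
        n + n                                ≤⟨ +-mono-≤ (n≤1+n n) (n≤1+n n) ⟩
        suc n + suc n                        ≤⟨ +-mono-≤ (<⇒≤ n<q*1+τ) (<⇒≤ n<q*1+τ) ⟩
        q * suc τ + q * suc τ                ≡⟨ cong (λ z → q * suc z + q * suc z) (sym s+2+j) ⟩
        q * suc (s + (2 + j)) + q * suc (s + (2 + j)) ≡⟨ expand q s j ⟩
        2 * q * s + 2 * q * (3 + j)          ≤⟨ +-monoʳ-≤ (2 * q * s) n≥n₀ ⟩
        2 * q * s + n                        ∎)
        where
        open ≤-Reasoning
        expand : ∀ q s j → q * (1 + (s + (2 + j))) + q * (1 + (s + (2 + j))) ≡ 2 * q * s + 2 * q * (3 + j)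
        expand = solve-∀

      module _ {M L e} (dense : suc r * M ≤ r * L) (comparable : suc n * L ≤ 2 * suc r * e) where

        pruned : ℕ
        pruned = j * (2 * (L * τ))

        -- The origin of the 8 in `q`: a 2 from the number of pairs, a 2 from the two sides pruned,
        -- and a 2 from allowing only half of the pairs to go. The factor `suc j` rather than `j`
        -- keeps `q` positive for a single edge.
        2*pruned≤e : pruned + pruned ≤ e
        2*pruned≤e = *-cancelˡ-≤ (2 * suc r) (begin
          2 * suc r * (pruned + pruned)       ≡⟨ collect r j L τ ⟩
          8 * suc r * j * τ * L               ≤⟨ *-monoˡ-≤ L (*-monoˡ-≤ τ (*-monoʳ-≤ (8 * suc r) (n≤1+n j))) ⟩
          q * τ * L                           ≤⟨ *-monoˡ-≤ L q*τ≤ ⟩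
          suc n * L                           ≤⟨ comparable ⟩
          2 * suc r * e                       ∎)
          where
          open ≤-Reasoning
          collect : ∀ r j L τ → 2 * (1 + r) * (j * (2 * (L * τ)) + j * (2 * (L * τ))) ≡ 8 * (1 + r) * j * τ * L
          collect = solve-∀

        e≤2*[e∸pruned] : e ≤ 2 * (e ∸ pruned)
        e≤2*[e∸pruned] = begin
          e                                ≡⟨ m∸n+n≡m (m+n≤o⇒m≤o pruned 2*pruned≤e) ⟨
          (e ∸ pruned) + pruned            ≤⟨ +-monoʳ-≤ (e ∸ pruned) (m+n≤o⇒m≤o∸n pruned 2*pruned≤e) ⟩
          (e ∸ pruned) + (e ∸ pruned)      ≡⟨ cong ((e ∸ pruned) +_) (+-identityʳ (e ∸ pruned)) ⟨
          2 * (e ∸ pruned)                 ∎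
          where open ≤-Reasoning

        M≤L : M ≤ L
        M≤L = *-cancelˡ-≤ (suc r) (≤-trans dense (*-monoˡ-≤ L (n≤1+n r)))

        -- One factor `n` comes from the number of comparable pairs, the other `j` from the choices
        -- for the leaves.
        count : ∀ {l} → (e ∸ pruned) * s ^ j ≤ l * (2 + j) ^ (2 + j) → n ^ suc j * M ≤ D * l
        count {l} enough = begin
          n * n ^ j * M                                          ≡⟨ swap n (n ^ j) M ⟩
          n ^ j * (n * M)                                        ≤⟨ *-mono-≤ (^-monoˡ-≤ j n≤2*q*s) (begin
            n * M                          ≤⟨ *-mono-≤ (n≤1+n n) M≤L ⟩
            suc n * L                      ≤⟨ comparable ⟩
            2 * suc r * e                  ≤⟨ *-monoʳ-≤ (2 * suc r) e≤2*[e∸pruned] ⟩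
            2 * suc r * (2 * (e ∸ pruned)) ∎) ⟩
          (2 * q * s) ^ j * (2 * suc r * (2 * (e ∸ pruned)))     ≡⟨ cong (_* (2 * suc r * (2 * (e ∸ pruned)))) (^-distribʳ-* j (2 * q) s) ⟩
          (2 * q) ^ j * s ^ j * (2 * suc r * (2 * (e ∸ pruned))) ≡⟨ regroup r ((2 * q) ^ j) (s ^ j) (e ∸ pruned) ⟩
          4 * suc r * (2 * q) ^ j * ((e ∸ pruned) * s ^ j)       ≤⟨ *-monoʳ-≤ (4 * suc r * (2 * q) ^ j) enough ⟩
          4 * suc r * (2 * q) ^ j * (l * (2 + j) ^ (2 + j))      ≡⟨ last (4 * suc r * (2 * q) ^ j) l _ ⟩
          D * l                                                  ∎
          where
          open ≤-Reasoning
          swap : ∀ a b c → a * b * c ≡ b * (a * c)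
          swap = solve-∀
          regroup : ∀ r a b x → a * b * (2 * (1 + r) * (2 * x)) ≡ 4 * (1 + r) * a * (x * b)
          regroup = solve-∀
          last : ∀ a l k → a * (l * k) ≡ a * k * l
          last = solve-∀

  many-copies-ℕ : ∀ t (_≼_ : Rel (Fin (suc t)) 0ℓ) → IsPartialOrder _≡_ _≼_ →
    FinPoset.IsTreePoset _≼_ → FinPoset.HasHeight _≼_ 2 → ∀ r →
    ∃[ D ] (NonZero D × ∃[ n₀ ] (∀ n → n ≥ n₀ → ∀ (F : List (Subset n)) → Unique F →
      suc r * midBinom n ≤ r * length F →
      Σ (List (Copy _≼_ F)) λ cs → AllPairs (λ c d → ¬ SameSubfamily c d) cs × n ^ t * midBinom n ≤ D * length cs))
  many-copies-ℕ t _≼_ po (connected , acyclic) height r with HeightTwoTree.spanning _≼_ po connected acyclic height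
  ... | j , T , vs , S , full = D , D≢0 , n₀ , bound
    where
    open Constants r j
    bound : ∀ n → n ≥ n₀ → ∀ (F : List (Subset n)) → Unique F → suc r * midBinom n ≤ r * length F →
      Σ (List (Copy _≼_ F)) λ cs → AllPairs (λ c d → ¬ SameSubfamily c d) cs × n ^ t * midBinom n ≤ D * length cs
    bound n n≥n₀ F F! dense =
      let cs , distinct , enough = many-copies _≼_ po connected acyclic height F F! S full
                                     (τ n≥n₀) (s n≥n₀) (≤-reflexive (s+2+j n≥n₀))
      in cs , distinct , subst (λ k → n ^ k * midBinom n ≤ D * length cs) (suc-injective (sym t≡))
        (count n≥n₀ {midBinom n} {length F} {edges _⊂?_} dense comparable {length cs} enough)
      where
      open Graph (_≟ˢ_ {n}) F F! using (edges)
      t≡ : suc t ≡ 2 + j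
      t≡ = m≡2+j _≼_ po connected acyclic height F F! S full
      comparable : suc n * length F ≤ 2 * suc r * edges _⊂?_
      -- The walk counts a pair at its upper member, `edges` at its lower one.
      comparable = comparabilities-proportional {r} {midBinom n} {length F} {suc n} {edges _⊂?_} dense
        (subst (λ z → suc n * length F ≤ suc n * midBinom n + 2 * z)
          (∑-comm F F (λ B A → 𝟙 (A ⊂? B))) (Comparabilities.comparabilities F F!))

-- Transfer between natural and rational inequalities.

module Rationals where

  open import Data.Integer as ℤ using (+_)
  import Data.Integer.Properties as ℤ
  open import Data.Nat as ℕ using (ℕ; zero; suc)
  import Data.Nat.Properties as ℕ
  open import Data.Rational
  open import Data.Rational.Properties
  open import Data.Rational.Solver using (module +-*-Solver)
  open import Data.Rational.Unnormalised as ℚᵘ using (mkℚᵘ; *≡*; *≤*)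
  import Data.Rational.Unnormalised.Properties as ℚᵘ

  toℚᵘ-ℕ→ℚ : ∀ a → toℚᵘ (ℕ→ℚ a) ℚᵘ.≃ mkℚᵘ (+ a) 0
  toℚᵘ-ℕ→ℚ a = toℚᵘ-fromℚᵘ (mkℚᵘ (+ a) 0)

  ℕ→ℚ-homo-+ : ∀ a b → ℕ→ℚ (a ℕ.+ b) ≡ ℕ→ℚ a + ℕ→ℚ b
  ℕ→ℚ-homo-+ a b = toℚᵘ-injective (begin
    toℚᵘ (ℕ→ℚ (a ℕ.+ b))                ≈⟨ toℚᵘ-ℕ→ℚ (a ℕ.+ b) ⟩
    mkℚᵘ (+ (a ℕ.+ b)) 0                ≈⟨ *≡* (cong₂ (λ x y → (x ℤ.+ y) ℤ.* + 1) (sym (ℤ.*-identityʳ (+ a))) (sym (ℤ.*-identityʳ (+ b)))) ⟩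
    mkℚᵘ (+ a) 0 ℚᵘ.+ mkℚᵘ (+ b) 0      ≈⟨ ℚᵘ.+-cong (toℚᵘ-ℕ→ℚ a) (toℚᵘ-ℕ→ℚ b) ⟨
    toℚᵘ (ℕ→ℚ a) ℚᵘ.+ toℚᵘ (ℕ→ℚ b)      ≈⟨ toℚᵘ-homo-+ (ℕ→ℚ a) (ℕ→ℚ b) ⟨
    toℚᵘ (ℕ→ℚ a + ℕ→ℚ b)                ∎)
    where open ℚᵘ.≃-Reasoning

  ℕ→ℚ-homo-* : ∀ a b → ℕ→ℚ (a ℕ.* b) ≡ ℕ→ℚ a * ℕ→ℚ b
  ℕ→ℚ-homo-* a b = toℚᵘ-injective (begin
    toℚᵘ (ℕ→ℚ (a ℕ.* b))                ≈⟨ toℚᵘ-ℕ→ℚ (a ℕ.* b) ⟩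
    mkℚᵘ (+ (a ℕ.* b)) 0                ≈⟨ *≡* (cong (ℤ._* + 1) (ℤ.pos-* a b)) ⟩
    mkℚᵘ (+ a) 0 ℚᵘ.* mkℚᵘ (+ b) 0      ≈⟨ ℚᵘ.*-cong (toℚᵘ-ℕ→ℚ a) (toℚᵘ-ℕ→ℚ b) ⟨
    toℚᵘ (ℕ→ℚ a) ℚᵘ.* toℚᵘ (ℕ→ℚ b)      ≈⟨ toℚᵘ-homo-* (ℕ→ℚ a) (ℕ→ℚ b) ⟨
    toℚᵘ (ℕ→ℚ a * ℕ→ℚ b)                ∎)
    where open ℚᵘ.≃-Reasoning

  ℕ→ℚ-mono-≤ : ∀ {a b} → a ℕ.≤ b → ℕ→ℚ a ≤ ℕ→ℚ b
  ℕ→ℚ-mono-≤ {a} {b} a≤b = toℚᵘ-cancel-≤ (ℚᵘ.≤-respˡ-≃ (ℚᵘ.≃-sym (toℚᵘ-ℕ→ℚ a))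
    (ℚᵘ.≤-respʳ-≃ (ℚᵘ.≃-sym (toℚᵘ-ℕ→ℚ b)) (*≤* (ℤ.*-monoʳ-≤-nonNeg (+ 1) (ℤ.+≤+ a≤b)))))

  ℕ→ℚ-cancel-≤ : ∀ {a b} → ℕ→ℚ a ≤ ℕ→ℚ b → a ℕ.≤ b
  ℕ→ℚ-cancel-≤ {a} {b} a≤b with ℚᵘ.≤-respˡ-≃ (toℚᵘ-ℕ→ℚ a) (ℚᵘ.≤-respʳ-≃ (toℚᵘ-ℕ→ℚ b) (toℚᵘ-mono-≤ a≤b))
  ... | *≤* a*1≤b*1 = ℤ.drop‿+≤+ (ℤ.*-cancelʳ-≤-pos (+ a) (+ b) (+ 1) a*1≤b*1)

  ℕ→ℚ-nonNeg : ∀ a → NonNegative (ℕ→ℚ a)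
  ℕ→ℚ-nonNeg a = normalize-nonNeg a 1

  -- Multiplying a positive fraction by its denominator `suc d` leaves the numerator, which is at
  -- least 1.
  multiple≥1 : ∀ ε → 0ℚ < ε → ∃[ r ] 1ℚ ≤ ε * ℕ→ℚ (suc r)
  multiple≥1 ε@(mkℚ (+ zero) d c) 0<ε with () ← positive 0<ε
  multiple≥1 ε@(mkℚ (ℤ.-[1+ k ]) d c) 0<ε with () ← positive 0<ε
  multiple≥1 ε@(mkℚ (+ suc k) d c) 0<ε = d , toℚᵘ-cancel-≤ (begin
    mkℚᵘ (+ 1) 0                                  ≤⟨ *≤* bound ⟩
    mkℚᵘ (+ suc k) d ℚᵘ.* mkℚᵘ (+ suc d) 0        ≃⟨ ℚᵘ.*-congˡ {mkℚᵘ (+ suc k) d} (toℚᵘ-ℕ→ℚ (suc d)) ⟨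
    toℚᵘ ε ℚᵘ.* toℚᵘ (ℕ→ℚ (suc d))                ≃⟨ toℚᵘ-homo-* ε (ℕ→ℚ (suc d)) ⟨
    toℚᵘ (ε * ℕ→ℚ (suc d))                        ∎)
    where
    open ℚᵘ.≤-Reasoning
    bound : + 1 ℤ.* + (suc d ℕ.* 1) ℤ.≤ (+ suc k ℤ.* + suc d) ℤ.* + 1
    bound rewrite ℤ.*-identityʳ (+ suc k ℤ.* + suc d) | ℤ.*-identityˡ (+ (suc d ℕ.* 1)) | ℕ.*-identityʳ (suc d) | sym (ℤ.pos-* (suc k) (suc d)) =
      ℤ.+≤+ (ℕ.m≤m+n (suc d) (k ℕ.* suc d))

  -- From `1 ≤ ε * r` follows `1 + r ≤ r * (1 + ε)`; multiplying by `M` clears the fraction.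
  surplus : ∀ ε r M L → 1ℚ ≤ ε * ℕ→ℚ r → (1ℚ + ε) * ℕ→ℚ M ≤ ℕ→ℚ L → suc r ℕ.* M ℕ.≤ r ℕ.* L
  surplus ε r M L 1≤εr dense = ℕ→ℚ-cancel-≤ (begin
    ℕ→ℚ (suc r ℕ.* M)                  ≡⟨ trans (ℕ→ℚ-homo-* (suc r) M) (cong (_* ℕ→ℚ M) (ℕ→ℚ-homo-+ 1 r)) ⟩
    (1ℚ + ℕ→ℚ r) * ℕ→ℚ M               ≤⟨ *-monoʳ-≤-nonNeg (ℕ→ℚ M) {{ℕ→ℚ-nonNeg M}} (+-monoˡ-≤ (ℕ→ℚ r) 1≤εr) ⟩
    (ε * ℕ→ℚ r + ℕ→ℚ r) * ℕ→ℚ M        ≡⟨ solve 3 (λ e r m → (e :* r :+ r) :* m := r :* ((con 1ℚ :+ e) :* m)) refl ε (ℕ→ℚ r) (ℕ→ℚ M) ⟩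
    ℕ→ℚ r * ((1ℚ + ε) * ℕ→ℚ M)         ≤⟨ *-monoˡ-≤-nonNeg (ℕ→ℚ r) {{ℕ→ℚ-nonNeg r}} dense ⟩
    ℕ→ℚ r * ℕ→ℚ L                      ≡⟨ ℕ→ℚ-homo-* r L ⟨
    ℕ→ℚ (r ℕ.* L)                      ∎)
    where
    open ≤-Reasoning
    open +-*-Solver

  reciprocal-bound : ∀ D .{{_ : ℕ.NonZero D}} x y {l} → x ℕ.* y ℕ.≤ D ℕ.* l → (+ 1 / D) * ℕ→ℚ x * ℕ→ℚ y ≤ ℕ→ℚ l
  reciprocal-bound D@(suc d) x y {l} xy≤Dl = begin
    δ * ℕ→ℚ x * ℕ→ℚ y             ≡⟨ trans (*-assoc δ (ℕ→ℚ x) (ℕ→ℚ y)) (cong (δ *_) (sym (ℕ→ℚ-homo-* x y))) ⟩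
    δ * ℕ→ℚ (x ℕ.* y)             ≤⟨ *-monoˡ-≤-nonNeg δ {{normalize-nonNeg 1 D}} (ℕ→ℚ-mono-≤ xy≤Dl) ⟩
    δ * ℕ→ℚ (D ℕ.* l)             ≡⟨ trans (cong (δ *_) (ℕ→ℚ-homo-* D l)) (sym (*-assoc δ (ℕ→ℚ D) (ℕ→ℚ l))) ⟩
    δ * ℕ→ℚ D * ℕ→ℚ l             ≡⟨ trans (cong (_* ℕ→ℚ l) δD≡1) (*-identityˡ (ℕ→ℚ l)) ⟩
    ℕ→ℚ l                         ∎
    where
    open ≤-Reasoning
    δ = + 1 / D
    δD≡1 : δ * ℕ→ℚ D ≡ 1ℚ
    δD≡1 = toℚᵘ-injective (ℚᵘ.≃-trans (toℚᵘ-homo-* δ (ℕ→ℚ D))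
      (ℚᵘ.≃-trans (ℚᵘ.*-cong (toℚᵘ-fromℚᵘ (mkℚᵘ (+ 1) d)) (toℚᵘ-ℕ→ℚ D))
        (*≡* (trans (ℤ.*-identityʳ (+ 1 ℤ.* + D)) (cong (λ z → + 1 ℤ.* + z) (sym (ℕ.*-identityʳ D)))))))

open import Data.Integer using (+_)
open import Data.Nat using (ℕ; suc; _≥_; _^_)
open import Data.Rational using (ℚ; _<_; _≤_; _*_; _+_; 0ℚ; 1ℚ; _/_)
open import Data.Rational.Properties using (positive⁻¹; normalize-pos)
open Counting using (many-copies-ℕ)
open Rationals using (multiple≥1; surplus; reciprocal-bound)

theorem1p5 : (t : ℕ) (_≼_ : Rel (Fin (suc t)) 0ℓ) → IsPartialOrder _≡_ _≼_ →
    FinPoset.IsTreePoset _≼_ → FinPoset.HasHeight _≼_ 2 →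
    (ε : ℚ) → 0ℚ < ε →
    ∃[ δ ] (0ℚ < δ × ∃[ n₀ ] (∀ (n : ℕ) → n ≥ n₀ →
    ∀ (F : List (Subset n)) → Unique F →
    (1ℚ + ε) * ℕ→ℚ (midBinom n) ≤ ℕ→ℚ (length F) →
    AtLeastCopies _≼_ F (δ * ℕ→ℚ (n ^ t) * ℕ→ℚ (midBinom n))))
theorem1p5 t _≼_ po tree height ε 0<ε =
  -- The density used is 1 + 1 / (r + 1), at most 1 + ε, and δ is the reciprocal of `D`.
  let r , 1≤ε*r = multiple≥1 ε 0<ε
      D , D≢0 , n₀ , copies = many-copies-ℕ t _≼_ po tree height (suc r)
  in (+ 1 / D) {{D≢0}} , positive⁻¹ ((+ 1 / D) {{D≢0}}) {{normalize-pos 1 D {{D≢0}}}} , n₀ , λ n n≥n₀ F F! large →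
    let cs , distinct , enough = copies n n≥n₀ F F! (surplus ε (suc r) (midBinom n) (length F) 1≤ε*r large)
    in cs , distinct , reciprocal-bound D {{D≢0}} (n ^ t) (midBinom n) enough
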